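{- For $k\ge1$ let $N_k=3^k+1$ and $L_k=\frac12(3^k-1)$. (1) For $1\le k_1<k_2<\cdots<k_n$, $$\dim_H(\mathcal{C}(1,N_{k_1},N_{k_2},\ldots,N_{k_n}))\ge\dim_H(\mathcal{C}(1,L_{k_n+1})).$$ Equality holds when $k_j=j$ for $1\le j\le n$. (2) For each fixed $n\ge1$, $$\liminf_{k\to\infty}\dim_H(\mathcal{C}(1,N_k,N_{k+1},\ldots,N_{k+n-1}))\ge\tfrac12\log_3 2\approx0.315464.$$ In particular, $\Gamma_\star\ge\frac12\log_3 2$.
   Context: $\mathbb{Z}_3$ denotes the $3$-adic integers with the $3$-adic metric ($|3|_3=1/3$), and $\dim_H$ is Hausdorff dimension with respect to it. $\Sigma_3\subset\mathbb{Z}_3$ is the set of all $\sum_{j\ge0}a_j3^j$ with every $a_j\in\{0,1\}$. For positive integers $M_1,\ldots,M_n$, $\mathcal{C}(1,M_1,\ldots,M_n)=\{\lambda\in\Sigma_3:M_i\lambda\in\Sigma_3\text{ for all }i\}$. For $k\ge1$, $\mathcal{E}_\star^{(k)}(\mathbb{Z}_3)$ is the set of $\lambda\in\mathbb{Z}_3$ for which there exist integers $1=M_1<M_2<\cdots<M_k$, all $M_i\equiv1\pmod3$, with $M_i\lambda\in\Sigma_3$ for all $1\le i\le k$. These sets are nested decreasing in $k$, and $\Gamma_\star:=\lim_{k\to\infty}\dim_H(\mathcal{E}_\star^{(k)}(\mathbb{Z}_3))$. -}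

module Defs where

open import Algebra.Definitions.RawSemiring using () renaming (_^_ to pow)
open import Data.Fin.Base using (Fin; toℕ) renaming (zero to fzero; suc to fsuc; _<_ to _<ᶠ_)
open import Data.Integer.Base as ℤ using (ℤ; +_)
import Data.Integer.Properties as ℤ
open import Data.Integer.Divisibility.Signed using (_∣_; divides; ∣n⇒∣m*n)
open import Data.Integer.Tactic.RingSolver using (solve-∀)
open import Data.Nat.Base using (ℕ; zero; suc; _+_; _*_; _∸_; _^_; _/_; _%_)
import Data.Nat.Base as ℕ
open import Data.Product.Base using (∃-syntax; Σ-syntax; _×_; _,_)
open import Data.Rational.Base as ℚ using (ℚ; 0ℚ; ½)
import Data.Rational.Properties as ℚ
open import Data.Vec.Functional using (Vector)
open import Level using (Level; 0ℓ; _⊔_) renaming (suc to lsuc)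
open import Relation.Binary.PropositionalEquality using (_≡_; subst; cong; trans)
open import Relation.Unary using (Pred; _∈_; _⊆_; ⋃)

private
  variable
    a b i : Level

infixr 8 _^ℚ_
_^ℚ_ : ℚ → ℕ → ℚ
_^ℚ_ = pow ℚ.+-*-rawSemiring

------------------------------------------------------------------------
-- Extended non-negative reals

-- An element of [0,∞] is given by its right cut, the set of rationals q
-- strictly above it; 0 is the set of all positive rationals and ∞ is the
-- empty set.  Classically the right cuts are exactly the points of [0,∞].
-- The universe level only records how large the propositions "x < q" are.

record ℝ≥0∞ (ℓ : Level) : Set (lsuc ℓ) where
  field
    _below_  : ℚ → Set ℓ
    positive : ∀ {q} → _below_ q → 0ℚ ℚ.< q
    upward   : ∀ {q r} → _below_ q → q ℚ.< r → _below_ r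
    rounded  : ∀ {q} → _below_ q → ∃[ r ] (r ℚ.< q × _below_ r)

infix 4 _<ℚ_ _≤_ _≈_

_<ℚ_ : ℝ≥0∞ a → ℚ → Set a
_<ℚ_ = ℝ≥0∞._below_

_≤_ : ℝ≥0∞ a → ℝ≥0∞ b → Set (a ⊔ b)
x ≤ y = ∀ q → y <ℚ q → x <ℚ q

_≈_ : ℝ≥0∞ a → ℝ≥0∞ b → Set (a ⊔ b)
x ≈ y = x ≤ y × y ≤ x

-- Negative rationals are sent to 0.
fromℚ : ℚ → ℝ≥0∞ 0ℓ
fromℚ p = record
  { _below_  = λ q → p ℚ.⊔ 0ℚ ℚ.< q
  ; positive = ℚ.≤-<-trans (ℚ.p≤q⊔p p 0ℚ)
  ; upward   = ℚ.<-trans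
  ; rounded  = λ h → let r , p<r , r<q = ℚ.<-dense h in r , r<q , p<r
  }

inf : {I : Set i} → (I → ℝ≥0∞ a) → ℝ≥0∞ (i ⊔ a)
inf x = record
  { _below_  = λ q → ∃[ k ] x k <ℚ q
  ; positive = λ (k , h) → ℝ≥0∞.positive (x k) h
  ; upward   = λ (k , h) q<r → k , ℝ≥0∞.upward (x k) h q<r
  ; rounded  = λ (k , h) → let r , r<q , h′ = ℝ≥0∞.rounded (x k) h in r , r<q , k , h′
  }

-- The supremum of the empty family is 0.
sup : {I : Set i} → (I → ℝ≥0∞ a) → ℝ≥0∞ (i ⊔ a)
sup x = record
  { _below_  = λ q → ∃[ r ] (0ℚ ℚ.< r × r ℚ.< q × (∀ k → x k <ℚ r))
  ; positive = λ (r , 0<r , r<q , h) → ℚ.<-trans 0<r r<q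
  ; upward   = λ (r , 0<r , r<q , h) q<t → r , 0<r , ℚ.<-trans r<q q<t , h
  ; rounded  = λ (r , 0<r , r<q , h) →
      let t , r<t , t<q = ℚ.<-dense r<q in t , t<q , r , 0<r , r<t , h
  }

infixl 6 _+ᴿ_
_+ᴿ_ : ℝ≥0∞ a → ℝ≥0∞ b → ℝ≥0∞ (a ⊔ b)
x +ᴿ y = inf {I = Σ[ (p , q) ∈ ℚ × ℚ ] (x <ℚ p × y <ℚ q)}
             (λ ((p , q) , _) → fromℚ (p ℚ.+ q))

half : ℝ≥0∞ a → ℝ≥0∞ a
half x = inf {I = ∃[ p ] x <ℚ p} (λ (p , _) → fromℚ (½ ℚ.* p))

-- x ^ s for a positive rational s = m / d in lowest terms:  x ^ s ≤ q  as
-- soon as  r ^ m ≤ q ^ d  for some rational r > x.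
infixr 8 _^ᴿ_
_^ᴿ_ : ℝ≥0∞ a → ℚ → ℝ≥0∞ a
x ^ᴿ s =
  inf {I = Σ[ q ∈ ℚ ] (0ℚ ℚ.≤ q × ∃[ r ] (x <ℚ r × r ^ℚ ℤ.∣ ℚ.↥ s ∣ ℚ.≤ q ^ℚ ℚ.↧ₙ s))}
      (λ (q , _) → fromℚ q)

-- log₃ n for n ≥ 1 is the infimum of the m / d ≥ 0 with n ≤ 3 ^ (m / d).
log₃ : ℕ → ℝ≥0∞ 0ℓ
log₃ n = inf {I = Σ[ s ∈ ℚ ] (0ℚ ℚ.≤ s × n ^ ℚ.↧ₙ s ℕ.≤ 3 ^ ℤ.∣ ℚ.↥ s ∣)}
             (λ (s , _) → fromℚ s)

partialSum : (ℕ → ℝ≥0∞ a) → ℕ → ℝ≥0∞ a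
partialSum x zero    = sup {I = Fin 0} (λ ())
partialSum x (suc n) = partialSum x n +ᴿ x n

infiniteSum : (ℕ → ℝ≥0∞ a) → ℝ≥0∞ a
infiniteSum x = sup (partialSum x)

liminf : (ℕ → ℝ≥0∞ a) → ℝ≥0∞ a
liminf x = sup λ m → inf λ j → x (m + j)

limsup : (ℕ → ℝ≥0∞ a) → ℝ≥0∞ a
limsup x = inf λ m → sup λ j → x (m + j)

infix 4 _⟶_
_⟶_ : (ℕ → ℝ≥0∞ a) → ℝ≥0∞ b → Set (a ⊔ b)
x ⟶ l = liminf x ≈ l × limsup x ≈ l

------------------------------------------------------------------------
-- 3-adic integers

infix 4 _≡_mod3^_
_≡_mod3^_ : ℤ → ℤ → ℕ → Set
x ≡ y mod3^ n = + (3 ^ n) ∣ x ℤ.- y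

-- The inverse limit of the rings ℤ / 3ⁿ, with residue classes given by
-- arbitrary representatives.
record ℤ₃ : Set where
  field
    residue  : ℕ → ℤ
    coherent : ∀ n → residue (suc n) ≡ residue n mod3^ n

open ℤ₃ public

infix 4 _≈₃_
_≈₃_ : ℤ₃ → ℤ₃ → Set
x ≈₃ y = ∀ n → residue x n ≡ residue y n mod3^ n

infixr 7 _·_
_·_ : ℕ → ℤ₃ → ℤ₃
M · x = record
  { residue  = λ n → + M ℤ.* residue x n
  ; coherent = λ n → subst (+ (3 ^ n) ∣_) (distrib (+ M) (residue x (suc n)) (residue x n))
                           (∣n⇒∣m*n (+ M) (coherent x n))
  }
  where
  distrib : ∀ m u v → m ℤ.* (u ℤ.- v) ≡ m ℤ.* u ℤ.- m ℤ.* v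
  distrib = solve-∀

digitSum : ∀ {d} → (ℕ → Fin d) → ℕ → ℕ
digitSum c zero    = 0
digitSum c (suc n) = digitSum c n + toℕ (c n) * 3 ^ n

-- The 3-adic number  Σ_{j ≥ 0} c j * 3ʲ.
series : ∀ {d} → (ℕ → Fin d) → ℤ₃
series c = record
  { residue  = λ n → + digitSum c n
  ; coherent = λ n → divides (+ toℕ (c n))
      (trans (cong (ℤ._- + digitSum c n) (ℤ.pos-+ (digitSum c n) (toℕ (c n) * 3 ^ n)))
      (trans (cancel (+ digitSum c n) (+ (toℕ (c n) * 3 ^ n)))
             (ℤ.pos-* (toℕ (c n)) (3 ^ n))))
  }
  where
  cancel : ∀ u v → (u ℤ.+ v) ℤ.- u ≡ v
  cancel = solve-∀

-- |x - y|₃ is the infimum of the 3⁻ⁿ with x ≡ y modulo 3ⁿ.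
dist : ℤ₃ → ℤ₃ → ℝ≥0∞ 0ℓ
dist x y = inf {I = ∃[ n ] residue x n ≡ residue y n mod3^ n}
               (λ (n , _) → fromℚ ((+ 1 ℚ./ 3) ^ℚ n))

------------------------------------------------------------------------
-- Hausdorff dimension

diam : Pred ℤ₃ 0ℓ → ℝ≥0∞ 0ℓ
diam U = sup {I = Σ[ (x , y) ∈ ℤ₃ × ℤ₃ ] (x ∈ U × y ∈ U)} (λ ((x , y) , _) → dist x y)

record Cover (A : Pred ℤ₃ 0ℓ) (δ : ℚ) : Set₁ where
  field
    piece  : ℕ → Pred ℤ₃ 0ℓ
    covers : A ⊆ ⋃ ℕ piece
    small  : ∀ n → diam (piece n) ≤ fromℚ δ

hausdorffMeasure : ℚ → Pred ℤ₃ 0ℓ → ℝ≥0∞ (lsuc 0ℓ)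
hausdorffMeasure s A =
  sup {I = ∃[ δ ] 0ℚ ℚ.< δ} λ (δ , _) →
    inf {I = Cover A δ} λ C → infiniteSum λ n → diam (Cover.piece C n) ^ᴿ s

-- The exponents at which the measure vanishes are upward closed, so
-- positive rational exponents give the same infimum as real ones.
dimH : Pred ℤ₃ 0ℓ → ℝ≥0∞ (lsuc 0ℓ)
dimH A = inf {I = Σ[ s ∈ ℚ ] (0ℚ ℚ.< s × hausdorffMeasure s A ≈ fromℚ 0ℚ)}
             (λ (s , _) → fromℚ s)

------------------------------------------------------------------------
-- Intersections of multiplicative translates of the Cantor set

Σ₃ : Pred ℤ₃ 0ℓ
Σ₃ x = Σ[ c ∈ (ℕ → Fin 2) ] x ≈₃ series c

-- 𝒞 (M₁, …, Mₙ) is the set 𝒞(1, M₁, …, Mₙ); the leading 1 is implicit.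
𝒞 : ∀ {n} → Vector ℕ n → Pred ℤ₃ 0ℓ
𝒞 M x = x ∈ Σ₃ × (∀ i → M i · x ∈ Σ₃)

StrictlyIncreasing : ∀ {n} → Vector ℕ n → Set
StrictlyIncreasing k = ∀ i j → i <ᶠ j → k i ℕ.< k j

-- ℰ⋆ k is the set with k + 1 multipliers M₁ < ⋯ < Mₖ₊₁.
ℰ⋆ : ℕ → Pred ℤ₃ 0ℓ
ℰ⋆ k x = Σ[ M ∈ Vector ℕ (suc k) ]
  ( M fzero ≡ 1
  × StrictlyIncreasing M
  × (∀ i → M i % 3 ≡ 1)
  × (∀ i → M i · x ∈ Σ₃))

N : ℕ → ℕ
N k = 3 ^ k + 1

L : ℕ → ℕ
L k = (3 ^ k ∸ 1) / 2

{-# OPTIONS --safe #-}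

-- If λ has 0-1 digits c, then N_e λ has digits c j + c (j - e) and L_{m+1} λ
-- has as digits the sums of c over windows of length m + 1, as long as these
-- stay below 3.  Hence N_e λ ∈ Σ₃ means that λ has no two ones at distance e,
-- and L_{m+1} λ ∈ Σ₃ that it has no two ones at distance at most m; (1) is an
-- inclusion of sets.
--
-- For (2), let the first k digits of each period of length P = 2k + n be free
-- and the others 0.  No two ones are then at distance k, …, k + n - 1.  The
-- uniform measure on these sequences gives the set dimension at least
-- (k / P) log₃ 2: a cover by pieces with small Σ diam ^ s becomes a family of
-- cylinders of Cantor space of total mass less than 1, and choosing one bit
-- after another such that the restricted family still has relative mass less
-- than 1 leads to a point outside of all of them.
module Submission where

open import Defs
open import Algebra.Bundles using (CommutativeRing)
import Algebra.Properties.CommutativeSemigroup as CommutativeSemigroupProperties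
import Algebra.Properties.Semiring.Exp as Exp
open import Axiom.ExcludedMiddle using (ExcludedMiddle)
open import Data.Fin.Base using (Fin; toℕ; fromℕ; fromℕ<; inject₁) renaming (zero to fzero; suc to fsuc)
import Data.Fin.Properties as Fin
open import Data.Integer.Base as ℤ using (ℤ; +_; 0ℤ)
open import Data.Integer.Divisibility.Signed as ℤ∣ using (_∣_; divides; ∣n⇒∣m*n)
import Data.Integer.Properties as ℤ
import Data.Integer.Tactic.RingSolver as ℤSolver
open import Data.List.Base using (List; length) renaming ([] to []ˡ; _∷_ to _∷ˡ_)
open import Data.Maybe.Base using (Maybe; just; nothing)
open import Data.Nat.Base as ℕ
  using (ℕ; zero; suc; _+_; _*_; _∸_; _^_; _%_; z≤n; s≤s; NonZero)
  renaming (_≤_ to _≤ᴺ_; _<_ to _<ᴺ_; _/_ to infixl 7 _div_)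
import Data.Nat.Coprimality as Coprime
import Data.Nat.DivMod as ℕ÷
import Data.Nat.Divisibility as ℕ∣
import Data.Nat.Properties as ℕ
import Data.Nat.Tactic.RingSolver as ℕSolver
open import Data.Product.Base using (∃-syntax; Σ-syntax; _×_; _,_; proj₁; proj₂)
open import Data.Rational.Base as ℚ using (ℚ; mkℚ; 0ℚ; 1ℚ; ½; *≤*; _/_)
import Data.Rational.Properties as ℚ
import Data.Rational.Unnormalised.Base as ℚᵘ
import Data.Rational.Unnormalised.Properties as ℚᵘ
open import Data.Sum.Base using (_⊎_; inj₁; inj₂)
open import Data.Unit.Base using (⊤; tt)
open import Data.Vec.Functional using (Vector; []; _∷_)
open import Function.Base using (_∘_)
open import Level using (0ℓ) renaming (suc to lsuc)
open import Relation.Binary.PropositionalEquality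
  using (_≡_; _≢_; refl; sym; trans; cong; cong₂; subst; subst₂; module ≡-Reasoning)
open import Relation.Nullary using (¬_; yes; no; contradiction)
open import Relation.Nullary.Decidable using (from-yes; _→-dec_; decidable-stable)
open import Relation.Unary using (Pred; _∈_; _⊆_)

-- Congruences modulo powers of 3

private
  variable
    l l′ : ℕ
    x y z : ℤ

  u+v-u≡v : ∀ u v → (u ℤ.+ v) ℤ.- u ≡ v
  u+v-u≡v = ℤSolver.solve-∀

-- _≡_mod3^_ unfolds to divisibility of the difference, from which Agda cannot
-- recover the two sides; the record keeps them inferable.
infix 4 _≋_[_]
record _≋_[_] (x y : ℤ) (n : ℕ) : Set where
  constructor cong-mod
  field
    congruence : x ≡ y mod3^ n

open _≋_[_]

≋-reflexive : x ≡ y → x ≋ y [ l ]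
≋-reflexive {x} refl = cong-mod (divides 0ℤ (ℤ.+-inverseʳ x))

≋-sym : x ≋ y [ l ] → y ≋ x [ l ]
≋-sym {x} {y} {l} (cong-mod p) =
  cong-mod (subst (+ (3 ^ l) ∣_) (swap x y) (ℤ∣.∣m⇒∣-m p))
  where
  swap : ∀ x y → ℤ.- (x ℤ.- y) ≡ y ℤ.- x
  swap = ℤSolver.solve-∀

≋-trans : x ≋ y [ l ] → y ≋ z [ l ] → x ≋ z [ l ]
≋-trans {x} {y} {l} {z} (cong-mod p) (cong-mod q) =
  cong-mod (subst (+ (3 ^ l) ∣_) (telescope x y z) (ℤ∣.∣m∣n⇒∣m+n p q))
  where
  telescope : ∀ x y z → (x ℤ.- y) ℤ.+ (y ℤ.- z) ≡ x ℤ.- z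
  telescope = ℤSolver.solve-∀

≋-*ˡ : ∀ k → x ≋ y [ l ] → k ℤ.* x ≋ k ℤ.* y [ l ]
≋-*ˡ {x} {y} {l} k (cong-mod p) =
  cong-mod (subst (+ (3 ^ l) ∣_) (distrib k x y) (∣n⇒∣m*n k p))
  where
  distrib : ∀ k x y → k ℤ.* (x ℤ.- y) ≡ k ℤ.* x ℤ.- k ℤ.* y
  distrib = ℤSolver.solve-∀

≋-+ˡ : ∀ z → x ≋ y [ l ] → z ℤ.+ x ≋ z ℤ.+ y [ l ]
≋-+ˡ {x} {y} {l} z (cong-mod p) = cong-mod (subst (+ (3 ^ l) ∣_) (cancel z x y) p)
  where
  cancel : ∀ z x y → x ℤ.- y ≡ (z ℤ.+ x) ℤ.- (z ℤ.+ y)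
  cancel = ℤSolver.solve-∀

≋-weaken : l ≤ᴺ l′ → x ≋ y [ l′ ] → x ≋ y [ l ]
≋-weaken {l} {l′} l≤l′ (cong-mod p) =
  cong-mod (ℤ∣.∣-trans (ℤ∣.∣ᵤ⇒∣ (ℕ∣.divides (3 ^ (l′ ∸ l)) (begin
    3 ^ l′                 ≡⟨ cong (3 ^_) (ℕ.m∸n+n≡m l≤l′) ⟨
    3 ^ (l′ ∸ l + l)       ≡⟨ ℕ.^-distribˡ-+-* 3 (l′ ∸ l) l ⟩
    3 ^ (l′ ∸ l) * 3 ^ l   ∎))) p)
  where open ≡-Reasoning

-- Base 3 expansions with arbitrary natural digits

-- Digits above 1 occur in sums of 0-1 sequences, before it is known that nothing carries;
-- `digitSum` admits only digits from a `Fin d`.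
value : (ℕ → ℕ) → ℕ → ℕ
value f zero    = 0
value f (suc n) = value f n + f n * 3 ^ n

value-coherent : ∀ f n → + value f (suc n) ≋ + value f n [ n ]
value-coherent f n = cong-mod (divides (+ f n) (begin
  + (v + f n * 3 ^ n) ℤ.- + v   ≡⟨ cong (ℤ._- + v) (ℤ.pos-+ v (f n * 3 ^ n)) ⟩
  + v ℤ.+ + (f n * 3 ^ n) ℤ.- + v   ≡⟨ u+v-u≡v (+ v) (+ (f n * 3 ^ n)) ⟩
  + (f n * 3 ^ n)   ≡⟨ ℤ.pos-* (f n) (3 ^ n) ⟩
  + f n ℤ.* + (3 ^ n) ∎))
  where
  open ≡-Reasoning
  v = value f n

value-cong : ∀ {f g} n → (∀ j → j <ᴺ n → f j ≡ g j) → value f n ≡ value g n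
value-cong zero    f≗g = refl
value-cong (suc n) f≗g =
  cong₂ _+_ (value-cong n (λ j j<n → f≗g j (ℕ.m<n⇒m<1+n j<n)))
            (cong (_* 3 ^ n) (f≗g n ℕ.≤-refl))

value-+ : ∀ f g n → value (λ j → f j + g j) n ≡ value f n + value g n
value-+ f g zero    = refl
value-+ f g (suc n) rewrite value-+ f g n =
  rearrange (value f n) (value g n) (f n) (g n) (3 ^ n)
  where
  rearrange : ∀ a b u v t → a + b + (u + v) * t ≡ a + u * t + (b + v * t)
  rearrange = ℕSolver.solve-∀

digitSum-value : ∀ {d} (c : ℕ → Fin d) n → digitSum c n ≡ value (toℕ ∘ c) n
digitSum-value c zero    = refl
digitSum-value c (suc n) = cong (_+ toℕ (c n) * 3 ^ n) (digitSum-value c n)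

private
  digit-unique : ∀ u v → u <ᴺ 3 → v <ᴺ 3 → + 3 ∣ + u ℤ.- + v → u ≡ v
  digit-unique u v u<3 v<3 p =
    trans (sym (Fin.toℕ-fromℕ< u<3))
      (trans (cong toℕ (check (fromℕ< u<3) (fromℕ< v<3) p′)) (Fin.toℕ-fromℕ< v<3))
    where
    check = from-yes (Fin.all? {n = 3} λ i → Fin.all? {n = 3} λ j →
      (3 ℕ∣.∣? ℤ.∣ + toℕ i ℤ.- + toℕ j ∣) →-dec (i Fin.≟ j))
    p′ = subst₂ (λ u v → 3 ℕ∣.∣ ℤ.∣ + u ℤ.- + v ∣)
      (sym (Fin.toℕ-fromℕ< u<3)) (sym (Fin.toℕ-fromℕ< v<3)) (ℤ∣.∣⇒∣ᵤ p)

-- Induction on the length: reduced modulo `3 ^ n`, the congruence gives the lower digits. These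
-- cancel in the difference, and dividing by `3 ^ n` leaves a congruence modulo 3 between the top
-- digits.
value-unique : ∀ {f g} n → (∀ j → j <ᴺ n → f j <ᴺ 3) → (∀ j → j <ᴺ n → g j <ᴺ 3) →
  + value f n ≋ + value g n [ n ] → ∀ j → j <ᴺ n → f j ≡ g j
value-unique {f} {g} (suc n) f<3 g<3 p = unique
  where
  open ≡-Reasoning
  lower : ∀ j → j <ᴺ n → f j ≡ g j
  lower = value-unique n (λ i → f<3 i ∘ ℕ.m<n⇒m<1+n) (λ i → g<3 i ∘ ℕ.m<n⇒m<1+n)
    (≋-trans (≋-sym (value-coherent f n))
      (≋-trans (≋-weaken (ℕ.n≤1+n n) p) (value-coherent g n)))
  cancel : ∀ a u v t → (a ℤ.+ u ℤ.* t) ℤ.- (a ℤ.+ v ℤ.* t) ≡ (u ℤ.- v) ℤ.* t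
  cancel = ℤSolver.solve-∀
  split : ∀ a u t → + (a + u * t) ≡ + a ℤ.+ + u ℤ.* + t
  split a u t = trans (ℤ.pos-+ a (u * t)) (cong (λ w → + a ℤ.+ w) (ℤ.pos-* u t))
  difference : + value f (suc n) ℤ.- + value g (suc n) ≡ (+ f n ℤ.- + g n) ℤ.* + (3 ^ n)
  difference = begin
    + (value f n + f n * 3 ^ n) ℤ.- + (value g n + g n * 3 ^ n)
      ≡⟨ cong (λ v → + (value f n + f n * 3 ^ n) ℤ.- + (v + g n * 3 ^ n)) (value-cong n lower) ⟨
    + (value f n + f n * 3 ^ n) ℤ.- + (value f n + g n * 3 ^ n)
      ≡⟨ cong₂ ℤ._-_ (split (value f n) (f n) (3 ^ n)) (split (value f n) (g n) (3 ^ n)) ⟩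
    (+ value f n ℤ.+ + f n ℤ.* + (3 ^ n)) ℤ.- (+ value f n ℤ.+ + g n ℤ.* + (3 ^ n))
      ≡⟨ cancel (+ value f n) (+ f n) (+ g n) (+ (3 ^ n)) ⟩
    (+ f n ℤ.- + g n) ℤ.* + (3 ^ n) ∎
  unique : ∀ j → j <ᴺ suc n → f j ≡ g j
  unique j j<1+n with ℕ.m<1+n⇒m<n∨m≡n j<1+n
  ... | inj₁ j<n  = lower j j<n
  ... | inj₂ refl = digit-unique (f n) (g n) (f<3 n ℕ.≤-refl) (g<3 n ℕ.≤-refl)
    (ℤ∣.*-cancelʳ-∣ (+ (3 ^ n)) {{ℕ.m^n≢0 3 n}} (subst₂ _∣_ (ℤ.pos-* 3 (3 ^ n)) difference (congruence p)))

-- Shifts and windows of digit sequences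

shift : ℕ → (ℕ → ℕ) → ℕ → ℕ
shift zero    f j       = f j
shift (suc e) f zero    = 0
shift (suc e) f (suc j) = shift e f j

shift-+ : ∀ e f i → shift e f (i + e) ≡ f i
shift-+ zero    f i = cong f (ℕ.+-identityʳ i)
shift-+ (suc e) f i = trans (cong (shift (suc e) f) (ℕ.+-suc i e)) (shift-+ e f i)

shift-suc : ∀ e f j → shift (suc e) f j ≡ shift 1 (shift e f) j
shift-suc e f zero    = refl
shift-suc e f (suc j) = refl

shift-< : ∀ e f j → j <ᴺ e → shift e f j ≡ 0
shift-< (suc e) f zero    j<e       = refl
shift-< (suc e) f (suc j) (s≤s j<e) = shift-< e f j j<e

-- The index `m` counts the steps back from `j`, so away from the start the sum has `m + 1` terms;
-- this matches `L (suc m)`.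
window : ℕ → (ℕ → ℕ) → ℕ → ℕ
window zero    f j       = f j
window (suc m) f zero    = f zero
window (suc m) f (suc j) = f (suc j) + window m f j

window-suc : ∀ m f j → window (suc m) f j ≡ f j + shift 1 (window m f) j
window-suc m f zero    = sym (ℕ.+-identityʳ (f zero))
window-suc m f (suc j) = refl

shift≤window : ∀ {e m} f → e ≤ᴺ m → ∀ j → shift e f j ≤ᴺ window m f j
shift≤window {zero}  {zero}  f e≤m       j       = ℕ.≤-refl
shift≤window {zero}  {suc m} f e≤m       zero    = ℕ.≤-refl
shift≤window {zero}  {suc m} f e≤m       (suc j) = ℕ.m≤m+n _ _
shift≤window {suc e} {suc m} f (s≤s e≤m) zero    = z≤n
shift≤window {suc e} {suc m} f (s≤s e≤m) (suc j) =
  ℕ.m≤n⇒m≤o+n (f (suc j)) (shift≤window f e≤m j)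

pair≤window : ∀ {e m} f → 1 ≤ᴺ e → e ≤ᴺ m → ∀ j → f j + shift e f j ≤ᴺ window m f j
pair≤window {suc e} {suc m} f 1≤e (s≤s e≤m) zero    = ℕ.≤-reflexive (ℕ.+-identityʳ _)
pair≤window {suc e} {suc m} f 1≤e (s≤s e≤m) (suc j) = ℕ.+-monoʳ-≤ (f (suc j)) (shift≤window f e≤m j)

window-mono : ∀ m f j → window m f j ≤ᴺ window (suc m) f j
window-mono zero    f zero    = ℕ.≤-refl
window-mono zero    f (suc j) = ℕ.m≤m+n _ _
window-mono (suc m) f zero    = ℕ.≤-refl
window-mono (suc m) f (suc j) = ℕ.+-monoʳ-≤ (f (suc j)) (window-mono m f j)

window-step : ∀ m f j → window m f (suc j) ≤ᴺ f (suc j) + window m f j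
window-step zero    f j = ℕ.m≤m+n _ _
window-step (suc m) f j = ℕ.+-monoʳ-≤ (f (suc j)) (window-mono m f j)

window-zero : ∀ m f → window m f 0 ≡ f 0
window-zero zero    f = refl
window-zero (suc m) f = refl

window≡0 : ∀ m f j → (∀ e → e ≤ᴺ m → shift e f j ≡ 0) → window m f j ≡ 0
window≡0 zero    f j       z = z 0 z≤n
window≡0 (suc m) f zero    z = z 0 z≤n
window≡0 (suc m) f (suc j) z =
  cong₂ _+_ (z 0 z≤n) (window≡0 m f j (λ e e≤m → z (suc e) (s≤s e≤m)))

window≤1 : ∀ m f → (∀ j → f j ≤ᴺ 1) →
  (∀ e → 1 ≤ᴺ e → e ≤ᴺ m → ∀ j → f j + shift e f j ≤ᴺ 1) → ∀ j → window m f j ≤ᴺ 1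
window≤1 zero    f f≤1 apart j       = f≤1 j
window≤1 (suc m) f f≤1 apart zero    = f≤1 zero
window≤1 (suc m) f f≤1 apart (suc j) with f (suc j) in eq | f≤1 (suc j)
... | zero    | _ = window≤1 m f f≤1 (λ e 1≤e e≤m → apart e 1≤e (ℕ.m≤n⇒m≤1+n e≤m)) j
... | suc zero | _ = ℕ.≤-reflexive (cong suc (window≡0 m f j λ e e≤m →
  ℕ.n≤0⇒n≡0 (ℕ.s≤s⁻¹ (subst (λ u → u + shift e f j ≤ᴺ 1) eq
    (apart (suc e) (s≤s z≤n) (s≤s e≤m) (suc j))))))
... | suc (suc _) | s≤s ()

-- Expansions of the multiples by `3 ^ e`, `N e` and `L m`

-- Only a congruence, since the shift pushes the top digit out of the `n` places; with one place
-- more, `shifted` is an equality.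
value-shift1 : ∀ f n → + value (shift 1 f) n ≋ + (3 * value f n) [ n ]
value-shift1 f zero    = ≋-reflexive refl
value-shift1 f (suc n) = ≋-trans (≋-reflexive (cong +_ (shifted n)))
  (≋-sym (cong-mod (divides (+ f n) (begin
    + (3 * (value f n + f n * 3 ^ n)) ℤ.- + (3 * value f n)
      ≡⟨ cong (λ w → + w ℤ.- + (3 * value f n)) (rearrange (value f n) (f n) (3 ^ n)) ⟩
    + (3 * value f n + f n * (3 * 3 ^ n)) ℤ.- + (3 * value f n)
      ≡⟨ cong (ℤ._- + (3 * value f n)) (ℤ.pos-+ (3 * value f n) (f n * (3 * 3 ^ n))) ⟩
    + (3 * value f n) ℤ.+ + (f n * (3 * 3 ^ n)) ℤ.- + (3 * value f n)
      ≡⟨ u+v-u≡v (+ (3 * value f n)) (+ (f n * (3 * 3 ^ n))) ⟩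
    + (f n * (3 * 3 ^ n))
      ≡⟨ ℤ.pos-* (f n) (3 * 3 ^ n) ⟩
    + f n ℤ.* + (3 ^ suc n) ∎))))
  where
  open ≡-Reasoning
  rearrange : ∀ a u t → 3 * (a + u * t) ≡ 3 * a + u * (3 * t)
  rearrange = ℕSolver.solve-∀
  shifted : ∀ n → value (shift 1 f) (suc n) ≡ 3 * value f n
  shifted zero    = refl
  shifted (suc n) = trans (cong (_+ f n * 3 ^ suc n) (shifted n))
    (sym (rearrange (value f n) (f n) (3 ^ n)))

value-shift : ∀ e f n → + value (shift e f) n ≋ + (3 ^ e * value f n) [ n ]
value-shift zero    f n = ≋-reflexive (cong +_ (sym (ℕ.*-identityˡ (value f n))))
value-shift (suc e) f n =
  ≋-trans (≋-reflexive (cong +_ (value-cong n (λ j _ → shift-suc e f j))))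
  (≋-trans (value-shift1 (shift e f) n)
  (≋-trans (≋-reflexive (ℤ.pos-* 3 (value (shift e f) n)))
  (≋-trans (≋-*ˡ (+ 3) (value-shift e f n))
  (≋-reflexive (trans (sym (ℤ.pos-* 3 (3 ^ e * value f n)))
    (cong +_ (sym (ℕ.*-assoc 3 (3 ^ e) (value f n)))))))))

value-pair : ∀ e f n → + value (λ j → f j + shift e f j) n ≋ + (N e * value f n) [ n ]
value-pair e f n =
  ≋-trans (≋-reflexive (trans (cong +_ (value-+ f (shift e f) n)) (ℤ.pos-+ (value f n) _)))
  (≋-trans (≋-+ˡ (+ value f n) (value-shift e f n))
  (≋-reflexive (trans (sym (ℤ.pos-+ (value f n) _)) (cong +_ (factor (3 ^ e) (value f n))))))
  where
  factor : ∀ t v → v + t * v ≡ (t + 1) * v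
  factor = ℕSolver.solve-∀

-- The number 1 + 3 + ⋯ + 3^(m-1), free of the subtraction and division in `L`. Its recursion
-- mirrors `window-suc`, which is what `value-window` uses.
repunit : ℕ → ℕ
repunit zero    = 0
repunit (suc m) = 1 + 3 * repunit m

L≡repunit : ∀ m → L m ≡ repunit m
L≡repunit m = trans (cong (λ w → (w ∸ 1) div 2) (3^≡ m)) (ℕ÷.m*n/n≡m (repunit m) 2)
  where
  3^≡ : ∀ m → 3 ^ m ≡ 1 + repunit m * 2
  3^≡ zero    = refl
  3^≡ (suc m) = trans (cong (3 *_) (3^≡ m)) (rearrange (repunit m))
    where
    rearrange : ∀ r → 3 * (1 + r * 2) ≡ 1 + (1 + 3 * r) * 2
    rearrange = ℕSolver.solve-∀

value-window : ∀ m f n → + value (window m f) n ≋ + (repunit (suc m) * value f n) [ n ]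
value-window zero    f n = ≋-reflexive (cong +_ (sym (ℕ.*-identityˡ (value f n))))
value-window (suc m) f n =
  ≋-trans (≋-reflexive (trans (cong +_ (trans (value-cong n (λ j _ → window-suc m f j))
    (value-+ f (shift 1 (window m f)) n))) (ℤ.pos-+ (value f n) _)))
  (≋-trans (≋-+ˡ (+ value f n) (value-shift1 (window m f) n))
  (≋-trans (≋-+ˡ (+ value f n) (≋-trans (≋-reflexive (ℤ.pos-* 3 (value (window m f) n)))
    (≋-*ˡ (+ 3) (value-window m f n))))
  (≋-reflexive (trans (cong (λ w → + value f n ℤ.+ w) (sym (ℤ.pos-* 3 (repunit (suc m) * value f n))))
    (trans (sym (ℤ.pos-+ (value f n) _)) (cong +_ (factor (repunit (suc m)) (value f n))))))))
  where
  factor : ∀ r v → v + 3 * (r * v) ≡ (1 + 3 * r) * v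
  factor = ℕSolver.solve-∀

-- Multiples of elements of Σ₃

toℕ≤1 : (i : Fin 2) → toℕ i ≤ᴺ 1
toℕ≤1 i = ℕ.s≤s⁻¹ (Fin.toℕ<n i)

digits : (c : ℕ → Fin 2) → ℕ → ℕ
digits c j = toℕ (c j)

-- Here `f` is the digit sequence of the multiple as computed place by place; since its entries are
-- at most 1, nothing carries and it serves as the sequence of ternary digits.
multiple∈Σ₃ : ∀ {M x c} f → (∀ j → f j ≤ᴺ 1) → x ≈₃ series c →
  (∀ n → + value f n ≋ + (M * value (digits c) n) [ n ]) → M · x ∈ Σ₃
multiple∈Σ₃ {M} {x} {c} f f≤1 x≈c p = c′ , λ n → congruence
  (≋-trans (≋-*ˡ (+ M) (cong-mod (x≈c n)))
  (≋-trans (≋-reflexive (trans (cong (λ v → + M ℤ.* + v) (digitSum-value c n))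
                               (sym (ℤ.pos-* M (value (digits c) n)))))
  (≋-trans (≋-sym (p n))
  (≋-reflexive (cong +_ (sym (trans (digitSum-value c′ n)
    (value-cong n λ j _ → Fin.toℕ-fromℕ< (s≤s (f≤1 j))))))))))
  where
  c′ : ℕ → Fin 2
  c′ j = fromℕ< (s≤s (f≤1 j))

multiple-value : ∀ {M x c c′} → x ≈₃ series c → M · x ≈₃ series c′ →
  ∀ n → + (M * value (digits c) n) ≋ + value (digits c′) n [ n ]
multiple-value {M} {x} {c} {c′} x≈c Mx≈c′ n =
  ≋-trans (≋-reflexive (trans (ℤ.pos-* M (value (digits c) n))
                              (cong (λ v → + M ℤ.* + v) (sym (digitSum-value c n)))))
  (≋-trans (≋-sym (≋-*ˡ (+ M) (cong-mod (x≈c n))))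
  (≋-trans (cong-mod (Mx≈c′ n)) (≋-reflexive (cong +_ (digitSum-value c′ n)))))

-- For a 0-1 sequence and `e` at least 1: no two ones at distance `e`. Stated as a bound on the
-- uncarried digits of the multiple by `N e`.
Apart : ℕ → (ℕ → ℕ) → Set
Apart e f = ∀ j → f j + shift e f j ≤ᴺ 1

Apart⇒N·∈Σ₃ : ∀ {e x c} → x ≈₃ series c → Apart e (digits c) → N e · x ∈ Σ₃
Apart⇒N·∈Σ₃ {e} {x} {c} x≈c apart =
  multiple∈Σ₃ {N e} {x} {c} _ apart x≈c (value-pair e (digits c))

shift≤1 : ∀ e f → (∀ j → f j ≤ᴺ 1) → ∀ j → shift e f j ≤ᴺ 1
shift≤1 zero    f f≤1 j       = f≤1 j
shift≤1 (suc e) f f≤1 zero    = z≤n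
shift≤1 (suc e) f f≤1 (suc j) = shift≤1 e f f≤1 j

-- A sum of two 0-1 digits is below 3, so by `value-unique` these sums are the true digits of the
-- multiple.
N·∈Σ₃⇒Apart : ∀ {e x c} → x ≈₃ series c → N e · x ∈ Σ₃ → Apart e (digits c)
N·∈Σ₃⇒Apart {e} {x} {c} x≈c (c′ , Nx≈c′) j =
  subst (_≤ᴺ 1) (sym (value-unique {λ j → digits c j + shift e (digits c) j} {digits c′} (suc j)
    (λ i _ → s≤s (ℕ.+-mono-≤ (toℕ≤1 (c i)) (shift≤1 e (digits c) (λ i → toℕ≤1 (c i)) i)))
    (λ i _ → s≤s (ℕ.m≤n⇒m≤1+n (toℕ≤1 (c′ i))))
    (≋-trans (value-pair e (digits c) (suc j))
      (multiple-value {N e} {x} {c} {c′} x≈c Nx≈c′ (suc j))) j ℕ.≤-refl)) (toℕ≤1 (c′ j))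

-- Window sums grow by at most 1 per step, so the first one exceeding 1 would
-- be a digit 2 produced without any carry.
L·∈Σ₃⇒window≤1 : ∀ {m x c} → x ≈₃ series c → L (suc m) · x ∈ Σ₃ →
  ∀ j → window m (digits c) j ≤ᴺ 1
L·∈Σ₃⇒window≤1 {m} {x} {c} x≈c (c′ , Lx≈c′) j = below (suc j) j ℕ.≤-refl
  where
  f = digits c
  congruent : ∀ n → + value (window m f) n ≋ + value (digits c′) n [ n ]
  congruent n = ≋-trans (value-window m f n)
    (multiple-value {repunit (suc m)} {x} {c} {c′} x≈c
      (subst (λ M → M · x ≈₃ series c′) (L≡repunit (suc m)) Lx≈c′) n)
  below : ∀ n j → j <ᴺ n → window m f j ≤ᴺ 1
  next≤2 : ∀ n → window m f n ≤ᴺ 2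
  next≤2 zero    = subst (_≤ᴺ 2) (sym (window-zero m f)) (ℕ.m≤n⇒m≤1+n (toℕ≤1 (c 0)))
  next≤2 (suc n) = ℕ.≤-trans (window-step m f n)
    (ℕ.+-mono-≤ (toℕ≤1 (c (suc n))) (below (suc n) n ℕ.≤-refl))
  below (suc n) j j<1+n = subst (_≤ᴺ 1)
    (sym (value-unique {window m f} {digits c′} (suc n) small
      (λ i _ → s≤s (ℕ.m≤n⇒m≤1+n (toℕ≤1 (c′ i)))) (congruent (suc n)) j j<1+n))
    (toℕ≤1 (c′ j))
    where
    small : ∀ i → i <ᴺ suc n → window m f i <ᴺ 3
    small i i<1+n with ℕ.m<1+n⇒m<n∨m≡n i<1+n
    ... | inj₁ i<n  = s≤s (ℕ.m≤n⇒m≤1+n (below n i i<n))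
    ... | inj₂ refl = s≤s (next≤2 n)

-- Two places at distance `k j`, between 1 and `m`, lie in a common window of `m + 1` places, and
-- window sums are at most 1.
𝒞-L⊆𝒞-N : ∀ {n m} (k : Vector ℕ n) → (∀ j → 1 ≤ᴺ k j) → (∀ j → k j ≤ᴺ m) →
  𝒞 (L (suc m) ∷ []) ⊆ 𝒞 (λ j → N (k j))
𝒞-L⊆𝒞-N {m = m} k 1≤k k≤m {x} ((c , x≈c) , Lx) = (c , x≈c) , λ j →
  Apart⇒N·∈Σ₃ {k j} {x} {c} x≈c λ i → ℕ.≤-trans
    (pair≤window (digits c) (1≤k j) (k≤m j) i)
    (L·∈Σ₃⇒window≤1 {m} {x} {c} x≈c (Lx fzero) i)

-- When every distance from 1 to `m` is excluded, a window of `m + 1` places holds at most one 1.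
𝒞-N⊆𝒞-L : ∀ {n} m (k : Vector ℕ n) → (∀ e → 1 ≤ᴺ e → e ≤ᴺ m → ∃[ j ] k j ≡ e) →
  𝒞 (λ j → N (k j)) ⊆ 𝒞 (L (suc m) ∷ [])
𝒞-N⊆𝒞-L m k onto {x} ((c , x≈c) , Nx) = (c , x≈c) , λ { fzero →
  subst (λ M → M · x ∈ Σ₃) (sym (L≡repunit (suc m)))
    (multiple∈Σ₃ {repunit (suc m)} {x} {c} (window m (digits c))
      (window≤1 m (digits c) (λ j → toℕ≤1 (c j)) apart) x≈c (value-window m (digits c))) }
  where
  apart : ∀ e → 1 ≤ᴺ e → e ≤ᴺ m → Apart e (digits c)
  apart e 1≤e e≤m with onto e 1≤e e≤m
  ... | j , refl = N·∈Σ₃⇒Apart {k j} {x} {c} x≈c (Nx j)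

-- Powers of rational numbers

private
  module ℚ-ring = CommutativeRing ℚ.+-*-commutativeRing
  open CommutativeSemigroupProperties ℚ-ring.*-commutativeSemigroup
    using () renaming (interchange to *-interchange; x∙yz≈y∙xz to x*yz≡y*xz)
  open CommutativeSemigroupProperties ℚ-ring.+-commutativeSemigroup
    using () renaming (interchange to +-interchange)
  open Exp ℚ-ring.semiring using (^-homo-*; ^-assocʳ)

<⇒≱ℚ : ∀ {p q} → p ℚ.< q → ¬ q ℚ.≤ p
<⇒≱ℚ p<q q≤p = ℚ.<-irrefl refl (ℚ.<-≤-trans p<q q≤p)

*-mono-≤-nonNeg : ∀ {p q r s} → 0ℚ ℚ.≤ q → 0ℚ ℚ.≤ r → p ℚ.≤ q → r ℚ.≤ s → p ℚ.* r ℚ.≤ q ℚ.* s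
*-mono-≤-nonNeg {q = q} {r} 0≤q 0≤r p≤q r≤s = ℚ.≤-trans
  (ℚ.*-monoʳ-≤-nonNeg r {{ℚ.nonNegative 0≤r}} p≤q)
  (ℚ.*-monoˡ-≤-nonNeg q {{ℚ.nonNegative 0≤q}} r≤s)

^ℚ-nonNeg : ∀ {p} n → 0ℚ ℚ.≤ p → 0ℚ ℚ.≤ p ^ℚ n
^ℚ-nonNeg zero    0≤p = from-yes (0ℚ ℚ.≤? 1ℚ)
^ℚ-nonNeg (suc n) 0≤p = *-mono-≤-nonNeg 0≤p ℚ.≤-refl 0≤p (^ℚ-nonNeg n 0≤p)

^ℚ-monoˡ-≤ : ∀ {p q} n → 0ℚ ℚ.≤ p → p ℚ.≤ q → p ^ℚ n ℚ.≤ q ^ℚ n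
^ℚ-monoˡ-≤ zero    0≤p p≤q = ℚ.≤-refl
^ℚ-monoˡ-≤ (suc n) 0≤p p≤q =
  *-mono-≤-nonNeg (ℚ.≤-trans 0≤p p≤q) (^ℚ-nonNeg n 0≤p) p≤q (^ℚ-monoˡ-≤ n 0≤p p≤q)

^ℚ-monoˡ-< : ∀ {p q} n → 0ℚ ℚ.≤ p → p ℚ.< q → p ^ℚ suc n ℚ.< q ^ℚ suc n
^ℚ-monoˡ-< {p} {q} zero    0≤p p<q =
  subst₂ ℚ._<_ (sym (ℚ.*-identityʳ p)) (sym (ℚ.*-identityʳ q)) p<q
^ℚ-monoˡ-< {p} {q} (suc n) 0≤p p<q = ℚ.≤-<-trans
  (ℚ.*-monoˡ-≤-nonNeg p {{ℚ.nonNegative 0≤p}} (ℚ.<⇒≤ (^ℚ-monoˡ-< n 0≤p p<q)))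
  (ℚ.*-monoˡ-<-pos (q ^ℚ suc n)
    {{ℚ.positive (ℚ.≤-<-trans (^ℚ-nonNeg (suc n) 0≤p) (^ℚ-monoˡ-< n 0≤p p<q))}} p<q)

^ℚ-cancelˡ-≤ : ∀ {p q} n .{{_ : NonZero n}} → 0ℚ ℚ.≤ q → p ^ℚ n ℚ.≤ q ^ℚ n → p ℚ.≤ q
^ℚ-cancelˡ-≤ (suc n) 0≤q pⁿ≤qⁿ = ℚ.≮⇒≥ λ q<p →
  <⇒≱ℚ (^ℚ-monoˡ-< n 0≤q q<p) pⁿ≤qⁿ

^ℚ-antimonoʳ-≤ : ∀ {p m n} → 0ℚ ℚ.≤ p → p ℚ.≤ 1ℚ → m ≤ᴺ n → p ^ℚ n ℚ.≤ p ^ℚ m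
^ℚ-antimonoʳ-≤ {p} {n = n} 0≤p p≤1 z≤n = subst (p ^ℚ n ℚ.≤_) (one n) (^ℚ-monoˡ-≤ n 0≤p p≤1)
  where
  one : ∀ n → 1ℚ ^ℚ n ≡ 1ℚ
  one zero    = refl
  one (suc n) = trans (ℚ.*-identityˡ _) (one n)
^ℚ-antimonoʳ-≤ {p} 0≤p p≤1 (s≤s m≤n) =
  ℚ.*-monoˡ-≤-nonNeg p {{ℚ.nonNegative 0≤p}} (^ℚ-antimonoʳ-≤ 0≤p p≤1 m≤n)

fromℕ′ : ℕ → ℚ
fromℕ′ n = mkℚ (+ n) 0 (Coprime.sym (Coprime.1-coprimeTo n))

fromℕ′-* : ∀ m n → fromℕ′ (m * n) ≡ fromℕ′ m ℚ.* fromℕ′ n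
fromℕ′-* m n = ℚ.toℚᵘ-injective (ℚᵘ.≃-sym (ℚᵘ.≃-trans
  (ℚ.toℚᵘ-homo-* (fromℕ′ m) (fromℕ′ n))
  (ℚᵘ.*≡* (cong (ℤ._* + 1) (sym (ℤ.pos-* m n))))))

fromℕ′-mono-≤ : ∀ {m n} → m ≤ᴺ n → fromℕ′ m ℚ.≤ fromℕ′ n
fromℕ′-mono-≤ m≤n = *≤* (ℤ.*-monoʳ-≤-nonNeg (+ 1) (ℤ.+≤+ m≤n))

⅓ : ℚ
⅓ = + 1 / 3

^ℚ-inverse : ∀ {p b} → p ℚ.* fromℕ′ b ≡ 1ℚ → ∀ n → p ^ℚ n ℚ.* fromℕ′ (b ^ n) ≡ 1ℚ
^ℚ-inverse         pb≡1 zero    = refl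
^ℚ-inverse {p} {b} pb≡1 (suc n) = begin
  p ℚ.* p ^ℚ n ℚ.* fromℕ′ (b * b ^ n)
    ≡⟨ cong (p ℚ.* p ^ℚ n ℚ.*_) (fromℕ′-* b (b ^ n)) ⟩
  p ℚ.* p ^ℚ n ℚ.* (fromℕ′ b ℚ.* fromℕ′ (b ^ n))
    ≡⟨ *-interchange p (p ^ℚ n) (fromℕ′ b) (fromℕ′ (b ^ n)) ⟩
  p ℚ.* fromℕ′ b ℚ.* (p ^ℚ n ℚ.* fromℕ′ (b ^ n))
    ≡⟨ cong₂ ℚ._*_ pb≡1 (^ℚ-inverse pb≡1 n) ⟩
  1ℚ ∎
  where open ≡-Reasoning

0≤½ : 0ℚ ℚ.≤ ½
0≤½ = from-yes (0ℚ ℚ.≤? ½)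

0≤⅓ : 0ℚ ℚ.≤ ⅓
0≤⅓ = from-yes (0ℚ ℚ.≤? ⅓)

½^≤⅓^ : ∀ {u v} → 3 ^ v ≤ᴺ 2 ^ u → ½ ^ℚ u ℚ.≤ ⅓ ^ℚ v
½^≤⅓^ {u} {v} 3^v≤2^u = begin
  ½ ^ℚ u
    ≡⟨ ℚ.*-identityʳ _ ⟨
  ½ ^ℚ u ℚ.* 1ℚ
    ≡⟨ cong (½ ^ℚ u ℚ.*_) (^ℚ-inverse {⅓} {3} refl v) ⟨
  ½ ^ℚ u ℚ.* (⅓ ^ℚ v ℚ.* fromℕ′ (3 ^ v))
    ≤⟨ ℚ.*-monoˡ-≤-nonNeg (½ ^ℚ u) {{ℚ.nonNegative (^ℚ-nonNeg u 0≤½)}}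
        (ℚ.*-monoˡ-≤-nonNeg (⅓ ^ℚ v) {{ℚ.nonNegative (^ℚ-nonNeg v 0≤⅓)}} (fromℕ′-mono-≤ 3^v≤2^u)) ⟩
  ½ ^ℚ u ℚ.* (⅓ ^ℚ v ℚ.* fromℕ′ (2 ^ u))
    ≡⟨ x*yz≡y*xz (½ ^ℚ u) (⅓ ^ℚ v) (fromℕ′ (2 ^ u)) ⟩
  ⅓ ^ℚ v ℚ.* (½ ^ℚ u ℚ.* fromℕ′ (2 ^ u))
    ≡⟨ cong (⅓ ^ℚ v ℚ.*_) (^ℚ-inverse {½} {2} refl u) ⟩
  ⅓ ^ℚ v ℚ.* 1ℚ
    ≡⟨ ℚ.*-identityʳ _ ⟩
  ⅓ ^ℚ v ∎
  where open ℚ.≤-Reasoning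

-- Covers of Cantor space by cylinders of total mass less than 1

-- nothing stands for the empty cylinder.
Cylinder : Set
Cylinder = Maybe (List (Fin 2))

mass : Cylinder → ℚ
mass nothing  = 0ℚ
mass (just w) = ½ ^ℚ length w

-- The trace on the half of Cantor space with first bit `b`, read as a cylinder in the remaining
-- bits; its mass is thus relative to that half.
residual : Fin 2 → Cylinder → Cylinder
residual b            nothing                    = nothing
residual b            (just []ˡ)                 = just []ˡ
residual fzero        (just (fzero ∷ˡ w))        = just w
residual fzero        (just (fsuc fzero ∷ˡ w))   = nothing
residual (fsuc fzero) (just (fzero ∷ˡ w))        = nothing
residual (fsuc fzero) (just (fsuc fzero ∷ˡ w))   = just w

residual-∷ : ∀ b w → residual b (just (b ∷ˡ w)) ≡ just w
residual-∷ fzero        w = refl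
residual-∷ (fsuc fzero) w = refl

mass-nonNeg : ∀ w → 0ℚ ℚ.≤ mass w
mass-nonNeg nothing  = ℚ.≤-refl
mass-nonNeg (just w) = ^ℚ-nonNeg (length w) 0≤½

halves : ∀ p → ½ ℚ.* p ℚ.+ ½ ℚ.* p ≡ p
halves p = trans (sym (ℚ.*-distribʳ-+ p ½ ½)) (ℚ.*-identityˡ p)

mass-residual : ∀ w →
  mass (residual fzero w) ℚ.+ mass (residual (fsuc fzero) w) ≡ mass w ℚ.+ mass w
mass-residual nothing                 = refl
mass-residual (just []ˡ)               = refl
mass-residual (just (fzero ∷ˡ w))      = trans (ℚ.+-identityʳ _) (sym (halves (½ ^ℚ length w)))
mass-residual (just (fsuc fzero ∷ˡ w)) = trans (ℚ.+-identityˡ _) (sym (halves (½ ^ℚ length w)))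

totalMass : (ℕ → Cylinder) → ℕ → ℚ
totalMass F zero    = 0ℚ
totalMass F (suc n) = totalMass F n ℚ.+ mass (F n)

totalMass-mono : ∀ F {m n} → m ≤ᴺ n → totalMass F m ℚ.≤ totalMass F n
totalMass-mono F m≤n = go (ℕ.≤⇒≤′ m≤n)
  where
  go : ∀ {m n} → m ℕ.≤′ n → totalMass F m ℚ.≤ totalMass F n
  go ℕ.≤′-refl               = ℚ.≤-refl
  go {n = suc n} (ℕ.≤′-step m≤n) = ℚ.≤-trans (go m≤n)
    (subst (ℚ._≤ totalMass F (suc n)) (ℚ.+-identityʳ _)
      (ℚ.+-monoʳ-≤ (totalMass F n) (mass-nonNeg (F n))))

totalMass-residual : ∀ F n →
  totalMass (residual fzero ∘ F) n ℚ.+ totalMass (residual (fsuc fzero) ∘ F) n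
    ≡ totalMass F n ℚ.+ totalMass F n
totalMass-residual F zero    = refl
totalMass-residual F (suc n) = trans
  (+-interchange (totalMass (residual fzero ∘ F) n) (mass (residual fzero (F n)))
                 (totalMass (residual (fsuc fzero) ∘ F) n) (mass (residual (fsuc fzero) (F n))))
  (trans (cong₂ ℚ._+_ (totalMass-residual F n) (mass-residual (F n)))
    (sym (+-interchange (totalMass F n) (mass (F n)) (totalMass F n) (mass (F n)))))

-- Only finite sums are kept below 1; this suffices since each single cylinder already occurs in a
-- finite sum.
Light : (ℕ → Cylinder) → Set
Light F = ∀ n → totalMass F n ℚ.< 1ℚ

Prefix : List (Fin 2) → (ℕ → Fin 2) → Set
Prefix []ˡ      b = ⊤
Prefix (c ∷ˡ w) b = c ≡ b 0 × Prefix w (b ∘ suc)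

initial : ℕ → (ℕ → Fin 2) → List (Fin 2)
initial zero    b = []ˡ
initial (suc n) b = b 0 ∷ˡ initial n (b ∘ suc)

length-initial : ∀ n b → length (initial n b) ≡ n
length-initial zero    b = refl
length-initial (suc n) b = cong suc (length-initial n (b ∘ suc))

initial-Prefix : ∀ n {b b′} → (∀ j → j <ᴺ n → b j ≡ b′ j) → Prefix (initial n b) b′
initial-Prefix zero    b≗b′ = tt
initial-Prefix (suc n) b≗b′ = b≗b′ 0 (s≤s z≤n) , initial-Prefix n (λ j j<n → b≗b′ (suc j) (s≤s j<n))

module _ (em : ExcludedMiddle 0ℓ) where

  Light⊎full : ∀ F → Light F ⊎ (∃[ n ] 1ℚ ℚ.≤ totalMass F n)
  Light⊎full F with em {∃[ n ] 1ℚ ℚ.≤ totalMass F n}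
  ... | yes full = inj₂ full
  ... | no ¬full = inj₁ λ n → ℚ.≰⇒> λ 1≤total → ¬full (n , 1≤total)

  -- The total mass is the mean of the relative masses in the two halves. If both halves reached 1,
  -- they would do so at a common stage `n`, and the whole family would reach 1 there.
  Light-residual : ∀ F → Light F → ∃[ b ] Light (residual b ∘ F)
  Light-residual F light with Light⊎full (residual fzero ∘ F) | Light⊎full (residual (fsuc fzero) ∘ F)
  ... | inj₁ light₀ | _           = fzero , light₀
  ... | inj₂ _      | inj₁ light₁ = fsuc fzero , light₁
  ... | inj₂ (n₀ , full₀) | inj₂ (n₁ , full₁) = contradiction
    (ℚ.+-mono-≤
      (ℚ.≤-trans full₀ (totalMass-mono (residual fzero ∘ F) (ℕ.m≤m⊔n n₀ n₁)))
      (ℚ.≤-trans full₁ (totalMass-mono (residual (fsuc fzero) ∘ F) (ℕ.m≤n⊔m n₀ n₁))))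
    (<⇒≱ℚ (subst (ℚ._< 1ℚ ℚ.+ 1ℚ) (sym (totalMass-residual F n)) (ℚ.+-mono-< (light n) (light n))))
    where n = n₀ ℕ.⊔ n₁

  path : ∀ F → Light F → ℕ → Fin 2
  path F light zero    = proj₁ (Light-residual F light)
  path F light (suc n) = path _ (proj₂ (Light-residual F light)) n

  -- If the path followed `w` to its end, the `i`-th cylinder would by then have become the whole
  -- space, whose mass 1 contradicts lightness.
  path-avoids : ∀ w F (light : Light F) i → F i ≡ just w → ¬ Prefix w (path F light)
  path-avoids []ˡ      F light i Fi≡w _ = <⇒≱ℚ (light (suc i))
    (ℚ.≤-trans (ℚ.≤-reflexive (trans (cong mass (sym Fi≡w)) (sym (ℚ.+-identityˡ _))))
      (ℚ.+-monoˡ-≤ (mass (F i)) (totalMass-mono F (z≤n {i}))))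
  path-avoids (c ∷ˡ w) F light i Fi≡w (refl , prefix) =
    path-avoids w _ (proj₂ (Light-residual F light)) i
      (trans (cong (residual c) Fi≡w) (residual-∷ c w)) prefix

  least : ∀ (Q : ℕ → Set) {j} → Q j → ∃[ i ] (Q i × (∀ l → l <ᴺ i → ¬ Q l))
  least Q {j} Qj with search j
    where
    search : ∀ n → (∃[ i ] (Q i × (∀ l → l <ᴺ i → ¬ Q l))) ⊎ (∀ l → l <ᴺ n → ¬ Q l)
    search zero    = inj₂ λ l ()
    search (suc n) with search n
    ... | inj₁ found = inj₁ found
    ... | inj₂ none with em {Q n}
    ...   | yes Qn = inj₁ (n , Qn , none)
    ...   | no ¬Qn = inj₂ λ l l<1+n Ql → case-split l Ql (ℕ.m<1+n⇒m<n∨m≡n l<1+n)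
      where
      case-split : ∀ l → Q l → l <ᴺ n ⊎ l ≡ n → _
      case-split l Ql (inj₁ l<n)  = none l l<n Ql
      case-split l Ql (inj₂ refl) = ¬Qn Ql
  ... | inj₁ found = found
  ... | inj₂ none  = j , Qj , none

-- Mass distribution principle for an embedded Cantor space

numerator : ℚ → ℕ
numerator s = ℤ.∣ ℚ.↥ s ∣

-- growth compares the two scales at bit j: (3 ^ - pos j) ^ s ≥ 2 ^ - (j + κ).
module MassDistribution
  (em : ExcludedMiddle 0ℓ) (s : ℚ) (κ : ℕ) (pos : ℕ → ℕ) (embed : (ℕ → Fin 2) → ℤ₃)
  (separates : ∀ {b b′ n j} → pos j <ᴺ n →
    residue (embed b) n ≋ residue (embed b′) n [ n ] → b j ≡ b′ j)
  (growth : ∀ j → 3 ^ (pos j * numerator s) ≤ᴺ 2 ^ ((j + κ) * ℚ.↧ₙ s))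
  where

  K : ℚ
  K = fromℕ′ (2 ^ κ)

  K*½^κ≡1 : K ℚ.* ½ ^ℚ κ ≡ 1ℚ
  K*½^κ≡1 = trans (ℚ.*-comm K (½ ^ℚ κ)) (^ℚ-inverse {½} {2} refl κ)

  instance
    K-nonNeg : ℚ.NonNegative K
    K-nonNeg = _

  K*-nonNeg : ∀ {q} → 0ℚ ℚ.≤ q → 0ℚ ℚ.≤ K ℚ.* q
  K*-nonNeg {q} 0≤q = subst (ℚ._≤ K ℚ.* q) (ℚ.*-zeroʳ K) (ℚ.*-monoˡ-≤-nonNeg K 0≤q)

  -- By `separates`, points that differ in bit `j` are congruent modulo `3 ^ n` only for `n` up to
  -- `pos j`, so their distance is at least 3^(-pos j).
  separated-diam : ∀ {U : Pred ℤ₃ 0ℓ} {b b′ j r} → embed b ∈ U → embed b′ ∈ U → b j ≢ b′ j →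
    diam U <ℚ r → ⅓ ^ℚ pos j ℚ.≤ r
  separated-diam {b = b} {b′} {j} b∈U b′∈U b≢b′ (r′ , _ , r′<r , close)
    with close ((embed b , embed b′) , b∈U , b′∈U)
  ... | (n , congruent) , ⅓ⁿ<r′ = begin
    ⅓ ^ℚ pos j
      ≤⟨ ^ℚ-antimonoʳ-≤ 0≤⅓ (from-yes (⅓ ℚ.≤? 1ℚ))
          (ℕ.≮⇒≥ λ pos<n → b≢b′ (separates pos<n (cong-mod congruent))) ⟩
    ⅓ ^ℚ n
      ≤⟨ ℚ.p≤p⊔q (⅓ ^ℚ n) 0ℚ ⟩
    ⅓ ^ℚ n ℚ.⊔ 0ℚ
      <⟨ ℚ.<-trans ⅓ⁿ<r′ r′<r ⟩
    _ ∎
    where open ℚ.≤-Reasoning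

  -- With s = m / d, `growth` compares the `d`-th power of `½ ^ℚ (j + κ)` with the `m`-th power of
  -- the diameter bound; `K` makes up for `κ`.
  separated-mass : ∀ {U : Pred ℤ₃ 0ℓ} {b b′ j q} → embed b ∈ U → embed b′ ∈ U → b j ≢ b′ j →
    (diam U ^ᴿ s) <ℚ q → ½ ^ℚ j ℚ.≤ K ℚ.* q
  separated-mass {b = b} {b′} {j} {q} b∈U b′∈U b≢b′ ((p , 0≤p , r , diam<r , rᵐ≤pᵈ) , p<q) = begin
    ½ ^ℚ j                             ≡⟨ ℚ.*-identityʳ (½ ^ℚ j) ⟨
    ½ ^ℚ j ℚ.* 1ℚ                      ≡⟨ cong (½ ^ℚ j ℚ.*_) (trans (ℚ.*-comm (½ ^ℚ κ) K) K*½^κ≡1) ⟨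
    ½ ^ℚ j ℚ.* (½ ^ℚ κ ℚ.* K)          ≡⟨ ℚ.*-assoc (½ ^ℚ j) (½ ^ℚ κ) K ⟨
    ½ ^ℚ j ℚ.* ½ ^ℚ κ ℚ.* K            ≡⟨ cong (ℚ._* K) (^-homo-* ½ j κ) ⟨
    ½ ^ℚ (j + κ) ℚ.* K                 ≡⟨ ℚ.*-comm (½ ^ℚ (j + κ)) K ⟩
    K ℚ.* ½ ^ℚ (j + κ)                 ≤⟨ ℚ.*-monoˡ-≤-nonNeg K root ⟩
    K ℚ.* p                            ≤⟨ ℚ.*-monoˡ-≤-nonNeg K (ℚ.≤-trans (ℚ.p≤p⊔q p 0ℚ) (ℚ.<⇒≤ p<q)) ⟩
    K ℚ.* q                            ∎
    where
    open ℚ.≤-Reasoning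
    m = numerator s
    d = ℚ.↧ₙ s
    root : ½ ^ℚ (j + κ) ℚ.≤ p
    root = ^ℚ-cancelˡ-≤ d 0≤p (begin
      (½ ^ℚ (j + κ)) ^ℚ d     ≡⟨ ^-assocʳ ½ (j + κ) d ⟩
      ½ ^ℚ ((j + κ) * d)      ≤⟨ ½^≤⅓^ {(j + κ) * d} {pos j * m} (growth j) ⟩
      ⅓ ^ℚ (pos j * m)        ≡⟨ ^-assocʳ ⅓ (pos j) m ⟨
      (⅓ ^ℚ pos j) ^ℚ m       ≤⟨ ^ℚ-monoˡ-≤ m (^ℚ-nonNeg (pos j) 0≤⅓)
                                  (separated-diam b∈U b′∈U b≢b′ diam<r) ⟩
      r ^ℚ m                  ≤⟨ rᵐ≤pᵈ ⟩
      p ^ℚ d                  ∎)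

  -- The summand ½ ^ (i + 2) pays for pieces with at most one point.
  record Shadow (i : ℕ) (U : Pred ℤ₃ 0ℓ) : Set where
    field
      cylinder : Cylinder
      contains : ∀ b → embed b ∈ U → ∃[ w ] (cylinder ≡ just w × Prefix w b)
      light    : ∀ q → (diam U ^ᴿ s) <ℚ q → mass cylinder ℚ.≤ K ℚ.* q ℚ.+ ½ ^ℚ (i + 2)

  -- Three cases: `U` contains no embedded sequence, only one, or several. In the last case the
  -- cylinder is the common prefix up to the first bit `j` at which some member differs from `b₀`,
  -- and `separated-mass` at `j` bounds its mass.
  shadow : ∀ i U → Shadow i U
  shadow i U with em {∃[ b ] embed b ∈ U}
  ... | no empty = record
    { cylinder = nothing
    ; contains = λ b b∈U → contradiction (b , b∈U) empty
    ; light    = λ q d<q → ℚ.+-mono-≤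
        (K*-nonNeg (ℚ.<⇒≤ (ℝ≥0∞.positive (diam U ^ᴿ s) d<q))) (^ℚ-nonNeg (i + 2) 0≤½)
    }
  ... | yes (b₀ , b₀∈U) with em {∃[ j ] ∃[ b ] (embed b ∈ U × b₀ j ≢ b j)}
  ...   | no single = record
    { cylinder = just (initial (i + 2) b₀)
    ; contains = λ b b∈U → _ , refl , initial-Prefix (i + 2) λ j _ →
        decidable-stable (b₀ j Fin.≟ b j) λ b₀≢b → single (j , b , b∈U , b₀≢b)
    ; light    = λ q d<q → subst₂ ℚ._≤_
        (trans (ℚ.+-identityˡ _) (cong (½ ^ℚ_) (sym (length-initial (i + 2) b₀)))) refl
        (ℚ.+-monoˡ-≤ (½ ^ℚ (i + 2)) (K*-nonNeg (ℚ.<⇒≤ (ℝ≥0∞.positive (diam U ^ᴿ s) d<q))))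
    }
  ...   | yes (_ , differs)
    with least em (λ j → ∃[ b ] (embed b ∈ U × b₀ j ≢ b j)) differs
  ...     | j , (b , b∈U , b₀≢b) , minimal = record
    { cylinder = just (initial j b₀)
    ; contains = λ b b∈U → _ , refl , initial-Prefix j λ l l<j →
        decidable-stable (b₀ l Fin.≟ b l) λ b₀≢b → minimal l l<j (b , b∈U , b₀≢b)
    ; light    = λ q d<q → subst₂ ℚ._≤_
        (trans (ℚ.+-identityʳ _) (cong (½ ^ℚ_) (sym (length-initial j b₀)))) refl
        (ℚ.+-mono-≤ (separated-mass b₀∈U b∈U b₀≢b d<q) (^ℚ-nonNeg (i + 2) 0≤½))
    }

  -- The extra summands ½^(i+2) for i < n add up to ½ - ½^(n+1); keeping the remainder on the left
  -- lets the induction close.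
  total-bound : ∀ (U : ℕ → Pred ℤ₃ 0ℓ) n q → partialSum (λ i → diam (U i) ^ᴿ s) n <ℚ q →
    totalMass (λ i → Shadow.cylinder (shadow i (U i))) n ℚ.+ ½ ^ℚ (n + 1) ℚ.≤ K ℚ.* q ℚ.+ ½
  total-bound U zero    q (r , 0<r , r<q , _) =
    ℚ.+-mono-≤ (K*-nonNeg (ℚ.<⇒≤ (ℚ.<-trans 0<r r<q))) (ℚ.≤-refl {½})
  total-bound U (suc n) q (((q₁ , q₂) , sum<q₁ , diam<q₂) , q₁+q₂<q) = begin
    T ℚ.+ M ℚ.+ ½ ^ℚ (suc n + 1)
      ≤⟨ ℚ.+-monoˡ-≤ e (ℚ.+-monoʳ-≤ T (subst (λ l → M ℚ.≤ K ℚ.* q₂ ℚ.+ ½ ^ℚ l) (ℕ.+-suc n 1)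
          (Shadow.light (shadow n (U n)) q₂ diam<q₂))) ⟩
    T ℚ.+ (K ℚ.* q₂ ℚ.+ e) ℚ.+ e
      ≡⟨ rearrange T (K ℚ.* q₂) e ⟩
    K ℚ.* q₂ ℚ.+ (T ℚ.+ (e ℚ.+ e))
      ≡⟨ cong (λ h → K ℚ.* q₂ ℚ.+ (T ℚ.+ h)) (halves (½ ^ℚ (n + 1))) ⟩
    K ℚ.* q₂ ℚ.+ (T ℚ.+ ½ ^ℚ (n + 1))
      ≤⟨ ℚ.+-monoʳ-≤ (K ℚ.* q₂) (total-bound U n q₁ sum<q₁) ⟩
    K ℚ.* q₂ ℚ.+ (K ℚ.* q₁ ℚ.+ ½)
      ≡⟨ ℚ.+-assoc (K ℚ.* q₂) (K ℚ.* q₁) ½ ⟨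
    K ℚ.* q₂ ℚ.+ K ℚ.* q₁ ℚ.+ ½
      ≡⟨ cong (ℚ._+ ½) (ℚ.*-distribˡ-+ K q₂ q₁) ⟨
    K ℚ.* (q₂ ℚ.+ q₁) ℚ.+ ½
      ≡⟨ cong (λ h → K ℚ.* h ℚ.+ ½) (ℚ.+-comm q₂ q₁) ⟩
    K ℚ.* (q₁ ℚ.+ q₂) ℚ.+ ½
      ≤⟨ ℚ.+-monoˡ-≤ ½ (ℚ.*-monoˡ-≤-nonNeg K
          (ℚ.≤-trans (ℚ.p≤p⊔q (q₁ ℚ.+ q₂) 0ℚ) (ℚ.<⇒≤ q₁+q₂<q))) ⟩
    K ℚ.* q ℚ.+ ½ ∎
    where
    open ℚ.≤-Reasoning
    T = totalMass (λ i → Shadow.cylinder (shadow i (U i))) n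
    M = mass (Shadow.cylinder (shadow n (U n)))
    e = ½ ^ℚ (suc n + 1)
    rearrange : ∀ t k e → t ℚ.+ (k ℚ.+ e) ℚ.+ e ≡ k ℚ.+ (t ℚ.+ (e ℚ.+ e))
    rearrange t k e = trans (ℚ.+-assoc t (k ℚ.+ e) e) (trans (cong (t ℚ.+_) (ℚ.+-assoc k e e))
      (trans (sym (ℚ.+-assoc t k _)) (trans (cong (ℚ._+ (e ℚ.+ e)) (ℚ.+-comm t k)) (ℚ.+-assoc k t _))))

  -- A cover with sum below `ε` has shadows of total mass below 1. A path avoiding all of them
  -- embeds to a point of `A` that no piece contains.
  measure≢0 : ∀ {A} → (∀ b → embed b ∈ A) → ¬ (hausdorffMeasure s A ≤ fromℚ 0ℚ)
  measure≢0 {A} embed∈A H≤0 =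
    let t , _ , t<ε , small    = H≤0 ε 0<ε
        C , r , _ , r<t , sums = small (1ℚ , from-yes (0ℚ ℚ.<? 1ℚ))
        S                      = λ i → shadow i (Cover.piece C i)
        light : Light (λ i → Shadow.cylinder (S i))
        light n = begin-strict
          totalMass _ n                              ≡⟨ ℚ.+-identityʳ _ ⟨
          totalMass _ n ℚ.+ 0ℚ                       ≤⟨ ℚ.+-monoʳ-≤ (totalMass _ n) (^ℚ-nonNeg (n + 1) 0≤½) ⟩
          totalMass _ n ℚ.+ ½ ^ℚ (n + 1)             ≤⟨ total-bound (Cover.piece C) n r (sums n) ⟩
          K ℚ.* r ℚ.+ ½                              <⟨ ℚ.+-monoˡ-< ½ (ℚ.*-monoʳ-<-pos K {{K-pos}} (ℚ.<-trans r<t t<ε)) ⟩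
          K ℚ.* ε ℚ.+ ½                              ≡⟨ cong (ℚ._+ ½) Kε≡½ ⟩
          1ℚ                                         ∎
        b                      = path em _ light
        i , b∈U                = Cover.covers C (embed∈A b)
        w , S≡w , prefix       = Shadow.contains (S i) b b∈U
    in path-avoids em w _ light i S≡w prefix
    where
    open ℚ.≤-Reasoning
    ε : ℚ
    -- Chosen so that `K ℚ.* ε` is ½; the other ½ is taken by the extra summands of the shadows.
    ε = ½ ℚ.* ½ ^ℚ κ
    Kε≡½ : K ℚ.* ε ≡ ½
    Kε≡½ = trans (sym (ℚ.*-assoc K ½ (½ ^ℚ κ))) (trans (cong (ℚ._* ½ ^ℚ κ) (ℚ.*-comm K ½))
      (trans (ℚ.*-assoc ½ K (½ ^ℚ κ)) (cong (½ ℚ.*_) K*½^κ≡1)))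
    K-pos : ℚ.Positive K
    K-pos = ℚ.positive (ℚ.<-≤-trans (from-yes (0ℚ ℚ.<? 1ℚ)) (fromℕ′-mono-≤ (ℕ.m^n>0 2 κ)))
    0<ε : 0ℚ ℚ.< ε
    0<ε = ℚ.*-cancelˡ-<-nonNeg K (subst₂ ℚ._<_ (sym (ℚ.*-zeroʳ K)) (sym Kε≡½) (from-yes (0ℚ ℚ.<? ½)))

-- In every period of length 2k + n only the first k digits are free: two ones
-- are then at distance less than k or at least k + n.
module Sparse (k n : ℕ) .{{k≢0 : NonZero k}} where

  P : ℕ
  P = k + (k + n)

  k≤P : k ≤ᴺ P
  k≤P = ℕ.m≤m+n k (k + n)

  instance
    P≢0 : NonZero P
    P≢0 = ℕ.>-nonZero (ℕ.<-≤-trans (ℕ.>-nonZero⁻¹ k) k≤P)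

  sparse : (ℕ → Fin 2) → ℕ → Fin 2
  sparse b j with j % P ℕ.<? k
  ... | yes _ = b (j div P * k + j % P)
  ... | no  _ = fzero

  sparse-free : ∀ b j → j % P <ᴺ k → sparse b j ≡ b (j div P * k + j % P)
  sparse-free b j j<k with j % P ℕ.<? k
  ... | yes _  = refl
  ... | no j≮k = contradiction j<k j≮k

  sparse-gap : ∀ b j → k ≤ᴺ j % P → sparse b j ≡ fzero
  sparse-gap b j k≤j with j % P ℕ.<? k
  ... | yes j<k = contradiction j<k (ℕ.≤⇒≯ k≤j)
  ... | no _    = refl

  -- The place of the `t`-th free digit, counted from 0.
  pos : ℕ → ℕ
  pos t = t % k + t div k * P

  pos-% : ∀ t → pos t % P ≡ t % k
  pos-% t = trans (ℕ÷.[m+kn]%n≡m%n (t % k) (t div k) P)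
    (ℕ÷.m<n⇒m%n≡m (ℕ.<-≤-trans (ℕ÷.m%n<n t k) k≤P))

  pos-/ : ∀ t → pos t div P ≡ t div k
  pos-/ t = begin
    (t % k + t div k * P) div P        ≡⟨ ℕ÷.+-distrib-/-∣ʳ (t % k) {d = P} (ℕ∣.n∣m*n (t div k)) ⟩
    t % k div P + t div k * P div P      ≡⟨ cong₂ _+_ (ℕ÷.m<n⇒m/n≡0 (ℕ.<-≤-trans (ℕ÷.m%n<n t k) k≤P))
                                               (ℕ÷.m*n/n≡m (t div k) P) ⟩
    t div k                          ∎
    where open ≡-Reasoning

  sparse-pos : ∀ b t → sparse b (pos t) ≡ b t
  sparse-pos b t = trans
    (sparse-free b (pos t) (subst (_<ᴺ k) (sym (pos-% t)) (ℕ÷.m%n<n t k)))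
    (cong b (begin
      pos t div P * k + pos t % P   ≡⟨ cong₂ (λ u v → u * k + v) (pos-/ t) (pos-% t) ⟩
      t div k * k + t % k           ≡⟨ ℕ.+-comm (t div k * k) (t % k) ⟩
      t % k + t div k * k           ≡⟨ ℕ÷.m≡m%n+[m/n]*n t k ⟨
      t                           ∎))
    where open ≡-Reasoning

  -- If the lower place `i` is free, then `i % P + (k + t)` is at least `k` and below `P`, so the
  -- upper place falls into the gap. Otherwise the lower digit is 0.
  sparse-apart : ∀ b t → t <ᴺ n → Apart (k + t) (digits (sparse b))
  sparse-apart b t t<n j with j ℕ.<? k + t
  ... | yes j<e = subst (λ v → digits (sparse b) j + v ≤ᴺ 1) (sym (shift-< (k + t) (digits (sparse b)) j j<e))
    (subst (_≤ᴺ 1) (sym (ℕ.+-identityʳ _)) (toℕ≤1 (sparse b j)))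
  ... | no j≮e = subst (λ j → digits (sparse b) j + shift (k + t) (digits (sparse b)) j ≤ᴺ 1)
    (ℕ.m∸n+n≡m (ℕ.≮⇒≥ j≮e))
    (subst (λ v → digits (sparse b) (i + (k + t)) + v ≤ᴺ 1) (sym (shift-+ (k + t) (digits (sparse b)) i)) pair)
    where
    i = j ∸ (k + t)
    wrapped : i % P <ᴺ k → (i + (k + t)) % P ≡ i % P + (k + t)
    wrapped i<k = begin
      (i + (k + t)) % P
        ≡⟨ cong (λ u → (u + (k + t)) % P) (ℕ÷.m≡m%n+[m/n]*n i P) ⟩
      (i % P + i div P * P + (k + t)) % P
        ≡⟨ cong (_% P) (rearrange (i % P) (i div P * P) (k + t)) ⟩
      (i % P + (k + t) + i div P * P) % P
        ≡⟨ ℕ÷.[m+kn]%n≡m%n (i % P + (k + t)) (i div P) P ⟩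
      (i % P + (k + t)) % P
        ≡⟨ ℕ÷.m<n⇒m%n≡m (ℕ.+-mono-<-≤ i<k (ℕ.+-monoʳ-≤ k (ℕ.<⇒≤ t<n))) ⟩
      i % P + (k + t) ∎
      where
      open ≡-Reasoning
      rearrange : ∀ a b c → a + b + c ≡ a + c + b
      rearrange = ℕSolver.solve-∀
    pair : digits (sparse b) (i + (k + t)) + digits (sparse b) i ≤ᴺ 1
    pair with i % P ℕ.<? k
    ... | yes i<k = subst (λ c → toℕ c + toℕ (b (i div P * k + i % P)) ≤ᴺ 1)
      (sym (sparse-gap b (i + (k + t)) (subst (k ≤ᴺ_) (sym (wrapped i<k))
        (ℕ.≤-trans (ℕ.m≤m+n k t) (ℕ.m≤n+m (k + t) (i % P))))))
      (toℕ≤1 (b (i div P * k + i % P)))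
    ... | no  _   = subst (_≤ᴺ 1) (sym (ℕ.+-identityʳ _)) (toℕ≤1 (sparse b (i + (k + t))))

  embed : (ℕ → Fin 2) → ℤ₃
  embed b = series (sparse b)

  embed∈𝒞 : ∀ b → embed b ∈ 𝒞 {n} (λ i → N (k + toℕ i))
  embed∈𝒞 b = (sparse b , x≈x) , λ i →
    Apart⇒N·∈Σ₃ {k + toℕ i} {embed b} {sparse b} x≈x (sparse-apart b (toℕ i) (Fin.toℕ<n i))
    where
    x≈x : embed b ≈₃ embed b
    x≈x m = _≋_[_].congruence (≋-reflexive {+ digitSum (sparse b) m} {l = m} refl)

  separates : ∀ {b b′ l j} → pos j <ᴺ l →
    residue (embed b) l ≋ residue (embed b′) l [ l ] → b j ≡ b′ j
  separates {b} {b′} {l} {j} pos<l p = trans (sym (sparse-pos b j)) (trans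
    (Fin.toℕ-injective (value-unique l (small b) (small b′)
      (≋-trans (≋-reflexive (cong +_ (sym (digitSum-value (sparse b) l))))
      (≋-trans p (≋-reflexive (cong +_ (digitSum-value (sparse b′) l))))) (pos j) pos<l))
    (sparse-pos b′ j))
    where
    small : ∀ b i → i <ᴺ l → digits (sparse b) i <ᴺ 3
    small b i _ = s≤s (ℕ.m≤n⇒m≤1+n (toℕ≤1 (sparse b i)))

  -- The hypothesis compares the scales over one period, of `P` places and `k` bits. Rounding
  -- `pos j` up to whole periods costs at most `k` further bits, hence κ = k.
  growth : ∀ m d → 3 ^ (P * m) ≤ᴺ 2 ^ (k * d) → ∀ j → 3 ^ (pos j * m) ≤ᴺ 2 ^ ((j + k) * d)
  growth m d 3^≤2^ j = begin
    3 ^ (pos j * m)               ≤⟨ ℕ.^-monoʳ-≤ 3 (ℕ.*-monoˡ-≤ m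
                                      (ℕ.+-monoˡ-≤ (j div k * P) (ℕ.≤-trans (ℕ.<⇒≤ (ℕ÷.m%n<n j k)) k≤P))) ⟩
    3 ^ (suc (j div k) * P * m)     ≡⟨ cong (3 ^_) (rotate (suc (j div k)) P m) ⟩
    3 ^ (P * m * suc (j div k))     ≡⟨ ℕ.^-*-assoc 3 (P * m) (suc (j div k)) ⟨
    (3 ^ (P * m)) ^ suc (j div k)   ≤⟨ ℕ.^-monoˡ-≤ (suc (j div k)) 3^≤2^ ⟩
    (2 ^ (k * d)) ^ suc (j div k)   ≡⟨ ℕ.^-*-assoc 2 (k * d) (suc (j div k)) ⟩
    2 ^ (k * d * suc (j div k))     ≡⟨ cong (2 ^_) (rotate (suc (j div k)) k d) ⟨
    2 ^ (suc (j div k) * k * d)     ≤⟨ ℕ.^-monoʳ-≤ 2 (ℕ.*-monoˡ-≤ d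
                                      (ℕ.≤-trans (ℕ.+-monoʳ-≤ k (ℕ÷.m/n*n≤m j k)) (ℕ.≤-reflexive (ℕ.+-comm k j)))) ⟩
    2 ^ ((j + k) * d)             ∎
    where
    open ℕ.≤-Reasoning
    rotate : ∀ a b c → a * b * c ≡ b * c * a
    rotate = ℕSolver.solve-∀

  -- The mass distribution principle in contrapositive form: for positive `s` the conclusion reads s
  -- > (k / P) log₃ 2.
  measure≤0⇒2^<3^ : ExcludedMiddle 0ℓ → ∀ s →
    hausdorffMeasure s (𝒞 {n} (λ i → N (k + toℕ i))) ≤ fromℚ 0ℚ →
    2 ^ (k * ℚ.↧ₙ s) <ᴺ 3 ^ (P * numerator s)
  measure≤0⇒2^<3^ em s H≤0 = ℕ.≰⇒> λ 3^≤2^ →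
    MassDistribution.measure≢0 em s k pos embed
      (λ {b} {b′} → separates {b} {b′}) (growth (numerator s) (ℚ.↧ₙ s) 3^≤2^)
      {𝒞 {n} (λ i → N (k + toℕ i))} embed∈𝒞 H≤0

-- The value ½ log₃ 2

^-cancelˡ-≤ : ∀ {m n} o .{{_ : NonZero o}} → m ^ o ≤ᴺ n ^ o → m ≤ᴺ n
^-cancelˡ-≤ o mᵒ≤nᵒ = ℕ.≮⇒≥ λ n<m → ℕ.<⇒≱ (ℕ.^-monoˡ-< o n<m) mᵒ≤nᵒ

+numerator : ∀ {p} → 0ℚ ℚ.≤ p → + numerator p ≡ ℚ.↥ p
+numerator {p@record{}} 0≤p = ℤ.0≤i⇒+∣i∣≡i (ℤ.nonNegative⁻¹ (ℚ.↥ p) {{ℚ.nonNegative 0≤p}})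

cross-< : ∀ {p q} → 0ℚ ℚ.≤ p → p ℚ.< q → numerator p * ℚ.↧ₙ q <ᴺ numerator q * ℚ.↧ₙ p
cross-< {p} {q} 0≤p p<q = ℤ.drop‿+<+ (subst₂ ℤ._<_
  (trans (cong (ℤ._* ℚ.↧ q) (sym (+numerator 0≤p))) (sym (ℤ.pos-* (numerator p) (ℚ.↧ₙ q))))
  (trans (cong (ℤ._* ℚ.↧ p) (sym (+numerator (ℚ.≤-trans 0≤p (ℚ.<⇒≤ p<q))))) (sym (ℤ.pos-* (numerator q) (ℚ.↧ₙ p))))
  (ℚ.drop-*<* p<q))

cross-half-< : ∀ {p q} → 0ℚ ℚ.≤ p → 0ℚ ℚ.≤ q → p ℚ.< ½ ℚ.* q →
  numerator p * (2 * ℚ.↧ₙ q) <ᴺ numerator q * ℚ.↧ₙ p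
cross-half-< {p@record{}} {q@record{}} 0≤p 0≤q p<½q = ℤ.drop‿+<+ (subst₂ ℤ._<_
  (trans (cong (ℤ._* + (2 * ℚ.↧ₙ q)) (sym (+numerator 0≤p))) (sym (ℤ.pos-* (numerator p) (2 * ℚ.↧ₙ q))))
  (trans (cong (ℤ._* ℚ.↧ p) (trans (ℤ.*-identityˡ (ℚ.↥ q)) (sym (+numerator 0≤q)))) (sym (ℤ.pos-* (numerator q) (ℚ.↧ₙ p))))
  (ℚᵘ.drop-*<* (ℚᵘ.<-respʳ-≃ (ℚ.toℚᵘ-homo-* ½ q) (ℚ.toℚᵘ-mono-< {p} {½ ℚ.* q} p<½q))))

⊔0-< : ∀ {p q} → p ℚ.< q → 0ℚ ℚ.< q → p ℚ.⊔ 0ℚ ℚ.< q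
⊔0-< {p} {q} p<q 0<q with ℚ.⊔-sel p 0ℚ
... | inj₁ eq = subst (ℚ._< q) (sym eq) p<q
... | inj₂ eq = subst (ℚ._< q) (sym eq) 0<q

⊔0-<⁻¹ : ∀ {p q} → p ℚ.⊔ 0ℚ ℚ.< q → p ℚ.< q
⊔0-<⁻¹ {p} = ℚ.≤-<-trans (ℚ.p≤p⊔q p 0ℚ)

½*-double : ∀ q → ½ ℚ.* (q ℚ.+ q) ≡ q
½*-double q = trans (ℚ.*-distribˡ-+ ½ q q) (halves q)

half-log₃2< : ∀ {s q} → 0ℚ ℚ.≤ s → 2 ^ ℚ.↧ₙ s ≤ᴺ 3 ^ numerator s → ½ ℚ.* s ℚ.< q →
  half (log₃ 2) <ℚ q
half-log₃2< {s} {q} 0≤s 2^≤3^ ½s<q =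
  -- Right cuts are open, so the witness for `log₃ 2` must lie strictly above `s`.
  let p , s<p , p<2q = ℚ.<-dense {s} {q ℚ.+ q}
        (ℚ.*-cancelˡ-<-nonNeg ½ (subst (½ ℚ.* s ℚ.<_) (sym (½*-double q)) ½s<q))
  in (p , (s , 0≤s , 2^≤3^) , ⊔0-< s<p (ℚ.≤-<-trans 0≤s s<p)) ,
     ⊔0-< (subst (½ ℚ.* p ℚ.<_) (½*-double q) (ℚ.*-monoʳ-<-pos ½ p<2q))
          (ℚ.≤-<-trans (ℚ.*-monoˡ-≤-nonNeg ½ 0≤s) ½s<q)

private
  -- 2 r < t, written rₙ / r_d < tₙ / (2 t_d), leaves room for the factor
  -- (2 k + n) / k in front of s < r once k exceeds n rₙ t_d.
  clear-denominators : ∀ {k n sₙ s_d rₙ r_d tₙ t_d} .{{_ : NonZero r_d}} →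
    sₙ * r_d <ᴺ rₙ * s_d → rₙ * (2 * t_d) <ᴺ tₙ * r_d → n * (rₙ * t_d) ≤ᴺ k →
    (k + (k + n)) * sₙ * t_d ≤ᴺ k * s_d * tₙ
  clear-denominators {k} {n} {sₙ} {s_d} {rₙ} {r_d} {tₙ} {t_d} s<r 2r<t n≤k =
    ℕ.*-cancelʳ-≤ _ _ r_d (begin
      (k + (k + n)) * sₙ * t_d * r_d            ≡⟨ e₁ (k + (k + n)) sₙ t_d r_d ⟩
      (k + (k + n)) * t_d * (sₙ * r_d)          ≤⟨ ℕ.*-monoʳ-≤ ((k + (k + n)) * t_d) (ℕ.<⇒≤ s<r) ⟩
      (k + (k + n)) * t_d * (rₙ * s_d)          ≡⟨ e₂ k n t_d rₙ s_d ⟩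
      (k * (rₙ * (2 * t_d)) + n * (rₙ * t_d)) * s_d   ≤⟨ ℕ.*-monoˡ-≤ s_d (ℕ.+-monoʳ-≤ (k * (rₙ * (2 * t_d))) n≤k) ⟩
      (k * (rₙ * (2 * t_d)) + k) * s_d          ≡⟨ e₃ k (rₙ * (2 * t_d)) s_d ⟩
      k * s_d * suc (rₙ * (2 * t_d))            ≤⟨ ℕ.*-monoʳ-≤ (k * s_d) 2r<t ⟩
      k * s_d * (tₙ * r_d)                      ≡⟨ ℕ.*-assoc (k * s_d) tₙ r_d ⟨
      k * s_d * tₙ * r_d                        ∎)
    where
    open ℕ.≤-Reasoning
    e₁ : ∀ p s t r → p * s * t * r ≡ p * t * (s * r)
    e₁ = ℕSolver.solve-∀
    e₂ : ∀ k n t r s → (k + (k + n)) * t * (r * s) ≡ (k * (r * (2 * t)) + n * (r * t)) * s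
    e₂ = ℕSolver.solve-∀
    e₃ : ∀ k u s → (k * u + k) * s ≡ k * s * (1 + u)
    e₃ = ℕSolver.solve-∀

-- An exponent s < r of vanishing measure exceeds (k / P) log₃ 2, and k / P tends to ½. For large
-- `k` this bounds log₃ 2 by t = 2h, where r < h < q leaves room for the error in k / P.
half-log₃2-bound : ExcludedMiddle 0ℓ → ∀ n {r q} → r ℚ.< q →
  (∀ m → ∃[ j ] dimH (𝒞 {n} (λ i → N (m + j + toℕ i))) <ℚ r) → half (log₃ 2) <ℚ q
half-log₃2-bound em n {r} {q} r<q dim<r with ℚ.<-dense r<q
-- This starting index gives the lower bound on `k` that `clear-denominators` asks for; the `suc`
-- keeps `k` nonzero.
... | h , r<h , h<q with dim<r (suc (n * (numerator r * ℚ.↧ₙ (h ℚ.+ h))))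
... | j , (s , 0<s , H≤0 , _) , s<r′ = half-log₃2< 0≤t (^-cancelˡ-≤ (k * d) {{ℕ.m*n≢0 k d}} (begin
  (2 ^ t_d) ^ (k * d)      ≡⟨ ℕ.^-*-assoc 2 t_d (k * d) ⟩
  2 ^ (t_d * (k * d))      ≡⟨ cong (2 ^_) (ℕ.*-comm t_d (k * d)) ⟩
  2 ^ (k * d * t_d)        ≡⟨ ℕ.^-*-assoc 2 (k * d) t_d ⟨
  (2 ^ (k * d)) ^ t_d      ≤⟨ ℕ.^-monoˡ-≤ t_d (ℕ.<⇒≤ (Sparse.measure≤0⇒2^<3^ k n em s H≤0)) ⟩
  (3 ^ (P * m)) ^ t_d      ≡⟨ ℕ.^-*-assoc 3 (P * m) t_d ⟩
  3 ^ (P * m * t_d)        ≤⟨ ℕ.^-monoʳ-≤ 3 (clear-denominators {k} {n} {m} {d} {numerator r} {ℚ.↧ₙ r} {tₙ} {t_d}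
                               (cross-< 0≤s s<r) (cross-half-< 0≤r 0≤t r<½t) (ℕ.≤-trans (ℕ.n≤1+n _) (ℕ.m≤m+n _ j))) ⟩
  3 ^ (k * d * tₙ)         ≡⟨ cong (3 ^_) (ℕ.*-comm (k * d) tₙ) ⟩
  3 ^ (tₙ * (k * d))       ≡⟨ ℕ.^-*-assoc 3 tₙ (k * d) ⟨
  (3 ^ tₙ) ^ (k * d)       ∎)) (subst (ℚ._< q) (sym (½*-double h)) h<q)
  where
  open ℕ.≤-Reasoning
  t   = h ℚ.+ h
  t_d = ℚ.↧ₙ t
  tₙ  = numerator t
  k   = suc (n * (numerator r * t_d)) + j
  m   = numerator s
  d   = ℚ.↧ₙ s
  P   = k + (k + n)
  s<r = ⊔0-<⁻¹ s<r′
  0≤s = ℚ.<⇒≤ 0<s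
  0≤r = ℚ.<⇒≤ (ℚ.<-trans 0<s s<r)
  0≤h = ℚ.≤-trans 0≤r (ℚ.<⇒≤ r<h)
  0≤t : 0ℚ ℚ.≤ t
  0≤t = ℚ.+-mono-≤ 0≤h 0≤h
  r<½t : r ℚ.< ½ ℚ.* t
  r<½t = subst (r ℚ.<_) (sym (½*-double h)) r<h
private
  -- The fractions a / b and m / d bound log₃ 2 from below and above; the chain 3^(ad) ≤ 2^(bd) ≤
  -- 3^(mb) compares them without logarithms.
  power-compare : ∀ {a b d m} → 3 ^ a ≤ᴺ 2 ^ b → 2 ^ d ≤ᴺ 3 ^ m → a * d ≤ᴺ m * b
  power-compare {a} {b} {d} {m} 3^a≤2^b 2^d≤3^m = ℕ.≮⇒≥ λ mb<ad →
    ℕ.<⇒≱ (ℕ.^-monoʳ-< 3 (s≤s (s≤s z≤n)) mb<ad) (begin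
      3 ^ (a * d)    ≡⟨ ℕ.^-*-assoc 3 a d ⟨
      (3 ^ a) ^ d    ≤⟨ ℕ.^-monoˡ-≤ d 3^a≤2^b ⟩
      (2 ^ b) ^ d    ≡⟨ ℕ.^-*-assoc 2 b d ⟩
      2 ^ (b * d)    ≡⟨ cong (2 ^_) (ℕ.*-comm b d) ⟩
      2 ^ (d * b)    ≡⟨ ℕ.^-*-assoc 2 d b ⟨
      (2 ^ d) ^ b    ≤⟨ ℕ.^-monoˡ-≤ b 2^d≤3^m ⟩
      (3 ^ m) ^ b    ≡⟨ ℕ.^-*-assoc 3 m b ⟩
      3 ^ (m * b)    ∎)
    where open ℕ.≤-Reasoning

  971/1539≤ : ∀ s → 0ℚ ℚ.≤ s → 2 ^ ℚ.↧ₙ s ≤ᴺ 3 ^ numerator s → + 971 / 1539 ℚ.≤ s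
  971/1539≤ s 0≤s 2^≤3^ = *≤* (subst₂ ℤ._≤_ (ℤ.pos-* 971 (ℚ.↧ₙ s))
    (trans (ℤ.pos-* (numerator s) 1539) (cong (ℤ._* + 1539) (+numerator 0≤s)))
    (ℤ.+≤+ (power-compare {971} {1539} {ℚ.↧ₙ s} {numerator s} (ℕ.≤ᵇ⇒≤ (3 ^ 971) (2 ^ 1539) tt) 2^≤3^)))

-- 971/1539 < log₃ 2 < 665/1054 come from the continued fraction of log₃ 2.
315464≤half-log₃2 : fromℚ (+ 315464 / 1000000) ≤ half (log₃ 2)
315464≤half-log₃2 q ((p , (s , 0≤s , 2^≤3^) , s<p) , ½p<q) = ⊔0-< (begin-strict
  + 315464 / 1000000       ≤⟨ from-yes (+ 315464 / 1000000 ℚ.≤? ½ ℚ.* (+ 971 / 1539)) ⟩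
  ½ ℚ.* (+ 971 / 1539)     ≤⟨ ℚ.*-monoˡ-≤-nonNeg ½ (971/1539≤ s 0≤s 2^≤3^) ⟩
  ½ ℚ.* s                    ≤⟨ ℚ.*-monoˡ-≤-nonNeg ½ (ℚ.<⇒≤ (⊔0-<⁻¹ {s} s<p)) ⟩
  ½ ℚ.* p                    <⟨ ⊔0-<⁻¹ {½ ℚ.* p} ½p<q ⟩
  q                          ∎)
  (ℚ.≤-<-trans (ℚ.p≤q⊔p (½ ℚ.* p) 0ℚ) ½p<q)
  where open ℚ.≤-Reasoning

half-log₃2≤315465 : half (log₃ 2) ≤ fromℚ (+ 315465 / 1000000)
half-log₃2≤315465 q x<q = half-log₃2< {+ 665 / 1054} (from-yes (0ℚ ℚ.≤? + 665 / 1054))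
  (ℕ.≤ᵇ⇒≤ (2 ^ 1054) (3 ^ 665) tt)
  (ℚ.≤-<-trans (from-yes (½ ℚ.* (+ 665 / 1054) ℚ.≤? + 315465 / 1000000)) (⊔0-<⁻¹ x<q))

-- Monotonicity of the dimension and the limit along the sets `ℰ⋆`

dimH-mono : ∀ {A B} → A ⊆ B → dimH A ≤ dimH B
dimH-mono {A} A⊆B q ((s , 0<s , H≤0 , _) , s<q) =
  (s , 0<s , measure≤0 , λ r → ℝ≥0∞.positive (hausdorffMeasure s A) {r}) , s<q
  where
  measure≤0 : hausdorffMeasure s A ≤ fromℚ 0ℚ
  measure≤0 r 0<r = let t , 0<t , t<r , small = H≤0 r 0<r in t , 0<t , t<r , λ δ →
    let C , h = small δ in record
      { piece  = Cover.piece C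
      ; covers = λ x∈A → Cover.covers C (A⊆B x∈A)
      ; small  = Cover.small C
      } , h

antitone⟶inf : ∀ {a} (x : ℕ → ℝ≥0∞ a) → (∀ {m n} → m ≤ᴺ n → x n ≤ x m) → x ⟶ inf x
antitone⟶inf x antitone =
  -- A supremum lies below `q` only through one `r` strictly below `q` that serves all indices;
  -- `rounded` supplies it.
  ( (λ q (k , xₖ<q) → let r , r<q , xₖ<r = ℝ≥0∞.rounded (x k) xₖ<q in
      r , ℝ≥0∞.positive (x k) xₖ<r , r<q , λ m → k , antitone (ℕ.m≤n+m k m) r xₖ<r)
  , (λ q (r , _ , r<q , below) → let j , x<r = below 0 in j , ℝ≥0∞.upward (x j) x<r r<q))
  ,
  ( (λ q (k , xₖ<q) → let r , r<q , xₖ<r = ℝ≥0∞.rounded (x k) xₖ<q in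
      k , r , ℝ≥0∞.positive (x k) xₖ<r , r<q , λ j → antitone (ℕ.m≤m+n k j) r xₖ<r)
  , (λ q (m , r , _ , r<q , below) → m + 0 , ℝ≥0∞.upward (x (m + 0)) (below 0) r<q))

ℰ⋆-suc : ∀ k → ℰ⋆ (suc k) ⊆ ℰ⋆ k
ℰ⋆-suc k (M , M₀≡1 , M-inc , M≡1 , Mx) =
  M ∘ inject₁ , M₀≡1 ,
  (λ i j i<j → M-inc (inject₁ i) (inject₁ j)
    (subst₂ _<ᴺ_ (sym (Fin.toℕ-inject₁ i)) (sym (Fin.toℕ-inject₁ j)) i<j)) ,
  M≡1 ∘ inject₁ , Mx ∘ inject₁

dimH-ℰ⋆-antitone : ∀ {m n} → m ≤ᴺ n → dimH (ℰ⋆ n) ≤ dimH (ℰ⋆ m)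
dimH-ℰ⋆-antitone m≤n = go (ℕ.≤⇒≤′ m≤n)
  where
  go : ∀ {m n} → m ℕ.≤′ n → dimH (ℰ⋆ n) ≤ dimH (ℰ⋆ m)
  go ℕ.≤′-refl           q d<q = d<q
  go (ℕ.≤′-step {n} m≤n) q d<q = dimH-mono {ℰ⋆ (suc n)} {ℰ⋆ n} (λ {x} → ℰ⋆-suc n {x}) q (go m≤n q d<q)

-- The multipliers are 1 followed by the `n` numbers N, `n + 1` in all as in `ℰ⋆ n`; they are 1
-- modulo 3 because `k` is positive.
𝒞-N⊆ℰ⋆ : ∀ n {k} → 1 ≤ᴺ k → 𝒞 {n} (λ i → N (k + toℕ i)) ⊆ ℰ⋆ n
𝒞-N⊆ℰ⋆ n {k@(suc k-1)} 1≤k {x} ((c , x≈c) , Nx) = M , refl , increasing , M≡1 , Mx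
  where
  M : Vector ℕ (suc n)
  M = 1 ∷ λ i → N (k + toℕ i)
  increasing : StrictlyIncreasing M
  increasing fzero    (fsuc j) i<j       = ℕ.+-monoˡ-< 1 (ℕ.m^n>0 3 (k + toℕ j))
  increasing (fsuc i) (fsuc j) (s≤s i<j) =
    ℕ.+-monoˡ-< 1 (ℕ.^-monoʳ-< 3 (s≤s (s≤s z≤n)) (ℕ.+-monoʳ-< k i<j))
  M≡1 : ∀ i → M i % 3 ≡ 1
  M≡1 fzero    = refl
  M≡1 (fsuc i) = trans (cong (_% 3) (trans (ℕ.+-comm (3 ^ (k + toℕ i)) 1)
    (cong suc (ℕ.*-comm 3 (3 ^ (k-1 + toℕ i)))))) (ℕ÷.[m+kn]%n≡m%n 1 (3 ^ (k-1 + toℕ i)) 3)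
  Mx : ∀ i → M i · x ∈ Σ₃
  Mx fzero    = c , λ m → subst (_≡ + digitSum c m mod3^ m) (sym (ℤ.*-identityˡ (residue x m))) (x≈c m)
  Mx (fsuc i) = Nx i

theorem4p8 : ExcludedMiddle 0ℓ →
    (∀ (n : ℕ) (k : Vector ℕ (suc n)) → 1 ≤ᴺ k fzero → StrictlyIncreasing k →
    dimH (𝒞 (L (suc (k (fromℕ n))) ∷ [])) ≤ dimH (𝒞 (λ j → N (k j)))
    × ((∀ j → k j ≡ suc (toℕ j)) →
    dimH (𝒞 (λ j → N (k j))) ≈ dimH (𝒞 (L (suc (k (fromℕ n))) ∷ []))))
    × (∀ (n : ℕ) → 1 ≤ᴺ n →
    half (log₃ 2) ≤ liminf (λ k → dimH (𝒞 {n} (λ i → N (k + toℕ i)))))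
    × (fromℚ (+ 315464 / 1000000) ≤ half (log₃ 2)
    × half (log₃ 2) ≤ fromℚ (+ 315465 / 1000000))
    × Σ[ Γ⋆ ∈ ℝ≥0∞ (lsuc 0ℓ) ]
    ((λ k → dimH (ℰ⋆ k)) ⟶ Γ⋆) × half (log₃ 2) ≤ Γ⋆
theorem4p8 em =
  (λ n k 1≤k₀ k-inc →
    let 𝒞-N = 𝒞 (λ j → N (k j))
        𝒞-L = 𝒞 (L (suc (k (fromℕ n))) ∷ [])
        lower = dimH-mono {𝒞-L} {𝒞-N}
          (λ {x} → 𝒞-L⊆𝒞-N k (positive n k 1≤k₀ k-inc) (≤last n k k-inc) {x})
    in lower , λ k≡ →
      dimH-mono {𝒞-N} {𝒞-L} (λ {x} → 𝒞-N⊆𝒞-L (k (fromℕ n)) k (onto n k k≡) {x}) , lower) ,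
  (λ n _ q (r , _ , r<q , below) → half-log₃2-bound em n r<q below) ,
  (315464≤half-log₃2 , half-log₃2≤315465) ,
  inf (λ k → dimH (ℰ⋆ k)) , antitone⟶inf (λ k → dimH (ℰ⋆ k)) dimH-ℰ⋆-antitone ,
  λ q (n , d<q) → let r , r<q , d<r = ℝ≥0∞.rounded (dimH (ℰ⋆ n)) d<q in
    -- The offset 1 makes the index `m + 1` positive, as `𝒞-N⊆ℰ⋆` requires.
    half-log₃2-bound em n r<q λ m → 1 ,
      dimH-mono {𝒞 {n} (λ i → N (m + 1 + toℕ i))} {ℰ⋆ n} (λ {x} → 𝒞-N⊆ℰ⋆ n (ℕ.m≤n+m 1 m) {x}) r d<r
  where
  positive : ∀ n (k : Vector ℕ (suc n)) → 1 ≤ᴺ k fzero → StrictlyIncreasing k → ∀ j → 1 ≤ᴺ k j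
  positive n k 1≤k₀ k-inc fzero    = 1≤k₀
  positive n k 1≤k₀ k-inc (fsuc j) = ℕ.≤-trans 1≤k₀ (ℕ.<⇒≤ (k-inc fzero (fsuc j) (s≤s z≤n)))
  ≤last : ∀ n (k : Vector ℕ (suc n)) → StrictlyIncreasing k → ∀ j → k j ≤ᴺ k (fromℕ n)
  ≤last n k k-inc j with j Fin.≟ fromℕ n
  ... | yes refl  = ℕ.≤-refl
  ... | no j≢last = ℕ.<⇒≤ (k-inc j (fromℕ n) (Fin.≤∧≢⇒< (Fin.≤fromℕ j) j≢last))
  onto : ∀ n (k : Vector ℕ (suc n)) → (∀ j → k j ≡ suc (toℕ j)) →
    ∀ e → 1 ≤ᴺ e → e ≤ᴺ k (fromℕ n) → ∃[ j ] k j ≡ e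
  onto n k k≡ (suc e) _ e<k = fromℕ< e<1+n , trans (k≡ _) (cong suc (Fin.toℕ-fromℕ< e<1+n))
    where e<1+n = subst (suc e ≤ᴺ_) (trans (k≡ (fromℕ n)) (cong suc (Fin.toℕ-fromℕ n))) e<k
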